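{- Let $K$ be a finite pure $k$-dimensional simplicial complex ($k\ge 1$) on the vertex set $[n]=\{1,\dots,n\}$. Then $$\sum_r \lambda_r(K)^2\ \le\ \sum_{r\ge1}\bigl(d^{\mathrm v,\mathsf T}_r(K)\bigr)^2 .$$ Moreover, equality holds if and only if $K$ is isomorphic to a shifted simplicial complex. More precisely, if equality holds and the vertices are labelled so that $\deg_K(1)\ge\deg_K(2)\ge\cdots\ge\deg_K(n)$, then $K$ is shifted in that labelling.
   Context: A simplicial complex $K$ on a finite vertex set is a collection of subsets closed under taking subsets; a face with $m+1$ vertices has dimension $m$, and $K_j$ is the set of $j$-dimensional faces. $K$ is $k$-dimensional if $k$ is the largest dimension of a face, and pure if every face lies in a $k$-face. Choose an orientation (an ordering of the vertices, up to even permutations) of each face. The boundary matrix $B_k=([\sigma:F])_{\sigma\in K_{k-1},F\in K_k}$ has $[\sigma:F]=0$ if $\sigma\not\subset F$, and if $F=[v_0,\dots,v_k]$ and $\sigma=F\setminus\{v_i\}$ then $[\sigma:F]=(-1)^i\operatorname{sgn}(\pi)$, where $\pi$ is the permutation carrying $(v_0,\dots,\widehat{v_i},\dots,v_k)$ to the chosen ordering of $\sigma$. The up-Laplacian is $L^{\mathrm{up}}_{k-1}(K)=B_kB_k^{\mathsf T}$; its spectrum does not depend on the orientations. $\lambda_1(K)\ge\lambda_2(K)\ge\cdots>0$ are its nonzero eigenvalues, counted with multiplicity. $\deg_K(v)=|\{\sigma\in K_k: v\in\sigma\}|$, and $d^{\mathrm v,\mathsf T}_r(K)=|\{i\in[n]:\deg_K(i)\ge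 r\}|$ for $r\ge1$. For $t$-element subsets $F=\{f_1<\cdots<f_t\}$ and $G=\{g_1<\cdots<g_t\}$ of $[n]$, write $F\le_P G$ if $f_r\le g_r$ for all $r$. A simplicial complex $K$ on $[n]$ is shifted if whenever $G\in K$, $F\subseteq[n]$, $|F|=|G|$ and $F\le_P G$, then $F\in K$. Isomorphic means equal after a bijective relabelling of the vertices. -}

module Defs where

open import Algebra.Apartness.Bundles using (HeytingField; HeytingCommutativeRing)
open import Algebra.Bundles using (CommutativeRing; Semiring)
import Algebra.Definitions.RawMonoid as RawMonoidDefs
import Algebra.Definitions.RawSemiring as RawSemiringDefs
open import Data.Bool.Base using (if_then_else_)
import Data.Bool.Properties as Boolₚ
open import Data.Fin.Base as Fin using (Fin; toℕ; punchIn)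
open import Data.Fin.Permutation using (Permutation′; _⟨$⟩ʳ_)
open import Data.Fin.Properties as Finₚ using (any?)
open import Data.Fin.Subset using (Subset; inside; outside; _∈_; _⊆_; ∣_∣) renaming (_-_ to _∖_)
open import Data.Fin.Subset.Properties using (_∈?_)
open import Data.Integer.Base as ℤ using (ℤ; -1ℤ; 0ℤ)
open import Data.List.Base
  using (List; []; _∷_; _++_; map; filter; foldr; length; lookup; removeAt; allFin; upTo)
import Data.List.Membership.Propositional as ListMembership
open import Data.List.Relation.Binary.Pointwise.Base using (Pointwise)
open import Data.List.Relation.Unary.All using (All)
open import Data.List.Relation.Unary.Linked using (Linked)
open import Data.List.Relation.Unary.Unique.Propositional using (Unique)
open import Data.Nat.Base as ℕ using (ℕ; zero; suc)
open import Data.Nat.ListAction using (sum)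
import Data.Nat.Properties as ℕₚ
open import Data.Product.Base using (Σ; ∃-syntax; _×_; _,_)
open import Data.Sum.Base using (_⊎_)
import Data.Vec.Base as Vec
import Data.Vec.Properties as Vecₚ
open import Function.Bundles using (_⇔_)
open import Level using (Level; _⊔_; 0ℓ) renaming (suc to lsuc)
open import Relation.Binary.Core using (Rel)
open import Relation.Binary.Definitions using (DecidableEquality)
open import Relation.Binary.PropositionalEquality.Core using (_≡_; trans; sym)
open import Relation.Binary.Structures using (IsStrictPartialOrder)
open import Relation.Nullary.Decidable using (yes; no; does; _×-dec_)
open import Relation.Nullary.Negation using (¬_)
open import Relation.Unary using (Pred; Decidable)

private
  variable
    n : ℕ

------------------------------------------------------------------------
-- The real numbers, axiomatised as a Cauchy-complete Archimedean ordered
-- field.  The formulation is the constructive one (an ordered Heyting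
-- field): it is satisfied by Cauchy reals and, classically, determines ℝ
-- up to isomorphism.

record RealNumbers (c ℓ₁ ℓ₂ ℓ₃ : Level) : Set (lsuc (c ⊔ ℓ₁ ⊔ ℓ₂ ⊔ ℓ₃)) where
  infix 4 _<_ _≤_ _≥_
  field
    heytingField : HeytingField c ℓ₁ ℓ₂

  open HeytingField heytingField public
    hiding (heytingCommutativeRing; apartnessRelation)

  commutativeRing : CommutativeRing c ℓ₁
  commutativeRing = HeytingCommutativeRing.commutativeRing
    (HeytingField.heytingCommutativeRing heytingField)

  open RawMonoidDefs (CommutativeRing.+-rawMonoid commutativeRing) public
    using () renaming (_×_ to _·_)

  field
    _<_                  : Rel Carrier ℓ₃
    isStrictPartialOrder : IsStrictPartialOrder _≈_ _<_
    #⇔<                  : ∀ {x y} → (x # y) ⇔ (x < y ⊎ y < x)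
    +-monoˡ-<            : ∀ {x y} z → x < y → x + z < y + z
    *-pos                : ∀ {x y} → 0# < x → 0# < y → 0# < x * y
    0<1                  : 0# < 1#
    archimedean          : ∀ x → ∃[ m ] x < m · 1#
    complete             : ∀ (s : ℕ → Carrier) →
      (∀ ε → 0# < ε → ∃[ N ] ∀ i j → N ℕ.≤ i → N ℕ.≤ j → s i < s j + ε) →
      ∃[ l ] ∀ ε → 0# < ε → ∃[ N ] ∀ i → N ℕ.≤ i → s i < l + ε × l < s i + ε

  _≤_ : Rel Carrier ℓ₃
  x ≤ y = ¬ (y < x)

  _≥_ : Rel Carrier ℓ₃
  x ≥ y = y ≤ x

  fromℕ : ℕ → Carrier
  fromℕ m = m · 1#

  fromℤ : ℤ → Carrier
  fromℤ (ℤ.+ m)    = fromℕ m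
  fromℤ ℤ.-[1+ m ] = - fromℕ (suc m)

  sumOfSquares : List Carrier → Carrier
  sumOfSquares xs = foldr _+_ 0# (map (λ x → x * x) xs)

------------------------------------------------------------------------
-- Matrices and spectra

Matrix : ∀ {a} → Set a → ℕ → ℕ → Set a
Matrix A r c = Fin r → Fin c → A

module _ {c ℓ} (R : CommutativeRing c ℓ) where
  open CommutativeRing R using (Carrier; _+_; _*_; -_; 0#; 1#; +-rawMonoid; semiring)
  open RawMonoidDefs +-rawMonoid using () renaming (sum to ∑)
  open RawSemiringDefs (Semiring.rawSemiring semiring) using (_^_)

  -- Laplace expansion along the first row.
  det : ∀ {N} → Matrix Carrier N N → Carrier
  det {zero}  A = 1#
  det {suc N} A = ∑ λ j →
    ((- 1#) ^ toℕ j) * (A Fin.zero j * det (λ r s → A (Fin.suc r) (punchIn j s)))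

  scalarMatrix : ∀ {N} → Carrier → Matrix Carrier N N
  scalarMatrix x i j = if does (i Finₚ.≟ j) then x else 0#

module _ {c ℓ₁ ℓ₂ ℓ₃} (ℝ : RealNumbers c ℓ₁ ℓ₂ ℓ₃) where
  open RealNumbers ℝ
  open RawSemiringDefs (Semiring.rawSemiring (CommutativeRing.semiring commutativeRing)) using (_^_)

  -- The characteristic polynomial det(xI − A), as a function of x.
  charPoly : ∀ {N} → Matrix ℤ N N → Carrier → Carrier
  charPoly A x =
    det commutativeRing λ i j → scalarMatrix commutativeRing x i j - fromℤ (A i j)

  -- λs lists the nonzero eigenvalues of A in weakly decreasing order, with
  -- multiplicity: det(xI − A) = x^z ∏ᵣ (x − λᵣ).  As ℝ is infinite, equality
  -- for all x is equality of polynomials.  For a positive semidefinite A the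
  -- λᵣ are automatically positive, so this is not demanded.
  record IsNonzeroSpectrum {N} (A : Matrix ℤ N N) (λs : List Carrier)
         : Set (c ⊔ ℓ₁ ⊔ ℓ₃) where
    field
      nonzero     : All (λ x → ¬ (x ≈ 0#)) λs
      descending  : Linked _≥_ λs
      nullity     : ℕ
      size        : nullity ℕ.+ length λs ≡ N
      charPoly-eq : ∀ x →
        charPoly A x ≈ (x ^ nullity) * foldr _*_ 1# (map (λ μ → x - μ) λs)

------------------------------------------------------------------------
-- Simplicial complexes

-- The vertex set {1,…,n} is Fin n.  A j-dimensional face is a face with
-- suc j elements.
record SimplicialComplex (n : ℕ) : Set₁ where
  field
    Face        : Pred (Subset n) 0ℓ
    Face?       : Decidable Face
    down-closed : ∀ {F G} → F ⊆ G → Face G → Face F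

open SimplicialComplex public

record IsPure (K : SimplicialComplex n) (k : ℕ) : Set where
  field
    hasFacet : ∃[ F ] Face K F × ∣ F ∣ ≡ suc k
    maximal  : ∀ {F} → Face K F → ∣ F ∣ ℕ.≤ suc k
    pure     : ∀ {F} → Face K F → ∃[ G ] Face K G × ∣ G ∣ ≡ suc k × F ⊆ G

allSubsets : ∀ n → List (Subset n)
allSubsets zero    = Vec.[] ∷ []
allSubsets (suc n) =
  map (inside Vec.∷_) (allSubsets n) ++ map (outside Vec.∷_) (allSubsets n)

facesOfSize : SimplicialComplex n → ℕ → List (Subset n)
facesOfSize {n} K m = filter (λ F → Face? K F ×-dec (∣ F ∣ ℕₚ.≟ m)) (allSubsets n)

numFacesOfSize : SimplicialComplex n → ℕ → ℕ
numFacesOfSize K m = length (facesOfSize K m)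

------------------------------------------------------------------------
-- Orientations and the up-Laplacian

-- A vertex ordering of every face, representing its orientation; the
-- values of `order` on non-faces are irrelevant.
record Orientation (K : SimplicialComplex n) : Set where
  open ListMembership using () renaming (_∈_ to _∈ˡ_)
  field
    order  : Subset n → List (Fin n)
    unique : ∀ {F} → Face K F → Unique (order F)
    vertex : ∀ {F} → Face K F → ∀ v → (v ∈ˡ order F) ⇔ (v ∈ F)

open Orientation public

position : List (Fin n) → Fin n → ℕ
position []       v = 0
position (u ∷ us) v = if does (u Finₚ.≟ v) then 0 else suc (position us v)

inversions : List ℕ → ℕ
inversions []       = 0
inversions (a ∷ as) = length (filter (ℕₚ._<? a) as) ℕ.+ inversions as

-- For two orderings us and ws of the same set, the sign of the permutation
-- carrying us to ws, whose one-line notation is `map (position us) ws`.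
sgn : List (Fin n) → List (Fin n) → ℤ
sgn us ws = -1ℤ ℤ.^ inversions (map (position us) ws)

_≟ˢ_ : DecidableEquality (Subset n)
_≟ˢ_ = Vecₚ.≡-dec Boolₚ._≟_

-- The number [σ : F] for faces with ∣ F ∣ = 1 + ∣ σ ∣; under this size
-- condition σ ⊆ F means that σ = F ∖ {vᵢ} for a (unique) index i.
incidence : {K : SimplicialComplex n} → Orientation K → Subset n → Subset n → ℤ
incidence ω σ F with any? (λ i → σ ≟ˢ (F ∖ lookup (order ω F) i))
... | yes (i , _) = (-1ℤ ℤ.^ toℕ i) ℤ.* sgn (removeAt (order ω F) i) (order ω σ)
... | no  _       = 0ℤ

-- B_k, with rows indexed by the (k−1)-faces and columns by the k-faces.
boundary : (K : SimplicialComplex n) → Orientation K → (k : ℕ) →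
           Matrix ℤ (numFacesOfSize K k) (numFacesOfSize K (suc k))
boundary K ω k i j =
  incidence ω (lookup (facesOfSize K k) i) (lookup (facesOfSize K (suc k)) j)

-- L^up_{k−1} = B_k B_kᵀ.
upLaplacian : (K : SimplicialComplex n) → Orientation K → (k : ℕ) →
              Matrix ℤ (numFacesOfSize K k) (numFacesOfSize K k)
upLaplacian K ω k i j = ∑ λ l → boundary K ω k i l ℤ.* boundary K ω k j l
  where open RawMonoidDefs ℤ.+-0-rawMonoid using () renaming (sum to ∑)

------------------------------------------------------------------------
-- Degrees

-- The number of k-faces containing v.
deg : SimplicialComplex n → ℕ → Fin n → ℕ
deg K k v = length (filter (v ∈?_) (facesOfSize K (suc k)))

degᵀ : SimplicialComplex n → ℕ → ℕ → ℕ
degᵀ {n} K k r = length (filter (λ v → r ℕₚ.≤? deg K k v) (allFin n))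

-- ∑_{r≥1} (degᵀ r)², truncated at the number of k-faces: no degree exceeds
-- it, so all later terms vanish.
degᵀ-squares : SimplicialComplex n → ℕ → ℕ
degᵀ-squares K k =
  sum (map (λ r → degᵀ K k (suc r) ℕ.^ 2) (upTo (numFacesOfSize K (suc k))))

------------------------------------------------------------------------
-- Shifted complexes and relabellings

-- The elements of F in increasing order.
elements : Subset n → List (Fin n)
elements {n} F = filter (_∈? F) (allFin n)

_≤ₚ_ : Subset n → Subset n → Set
F ≤ₚ G = Pointwise Fin._≤_ (elements F) (elements G)

Shifted : SimplicialComplex n → Set
Shifted K = ∀ {F G} → Face K G → ∣ F ∣ ≡ ∣ G ∣ → F ≤ₚ G → Face K F

-- The preimage of F under π.
preimage : Permutation′ n → Subset n → Subset n
preimage π F = Vec.tabulate λ v → Vec.lookup F (π ⟨$⟩ʳ v)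

-- K with each vertex v renamed to π v.
relabel : Permutation′ n → SimplicialComplex n → SimplicialComplex n
relabel π K = record
  { Face        = λ F → Face K (preimage π F)
  ; Face?       = λ F → Face? K (preimage π F)
  ; down-closed = λ {F} {G} F⊆G → down-closed K (mono F G F⊆G)
  }
  where
  mono : ∀ F G → F ⊆ G → preimage π F ⊆ preimage π G
  mono F G F⊆G {v} v∈ = Vecₚ.lookup⇒[]= v _
    (trans (Vecₚ.lookup∘tabulate _ v)
      (Vecₚ.[]=⇒lookup (F⊆G (Vecₚ.lookup⇒[]= (π ⟨$⟩ʳ v) F
        (trans (sym (Vecₚ.lookup∘tabulate _ v)) (Vecₚ.[]=⇒lookup v∈))))))

-- Equal, as collections of subsets, after a relabelling.
_≅_ : SimplicialComplex n → SimplicialComplex n → Set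
_≅_ {n} K K′ = Σ (Permutation′ n) λ π → ∀ F → Face (relabel π K) F ⇔ Face K′ F

DegreesDescending : SimplicialComplex n → ℕ → Set
DegreesDescending K k = ∀ {i j} → i Fin.≤ j → deg K k j ℕ.≤ deg K k i

{-# OPTIONS --safe #-}

-- Since λ ↦ ∑ λ² is tr ((BBᵀ)²) = tr ((BᵀB)²), it is the sum of the squared entries of the Gram
-- matrix BᵀB: m (k+1)² from the diagonal, m being the number of facets, plus one for each ordered
-- pair of facets that differ by exchanging a vertex i for a vertex j.  Writing ex(i,j) for the
-- number of these and a(i,j) for the number of facets containing i but not j, the other side is
-- ∑ᵢⱼ min (deg i, deg j) = m (k+1)² + ∑ᵢⱼ min (a(i,j), a(j,i)), and ex(i,j) = ex(j,i) ≤ a(i,j).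
-- Equality means that ex(i,j) = a(i,j) whenever deg i ≤ deg j: in every facet, i may be replaced
-- with the vertex j of larger degree, which is shiftedness in the order of decreasing degree.
--
-- The power sum of the spectrum is read off the characteristic polynomial: det (I + yA) and
-- ∏ (1 + λy) are the same polynomial in y = −1/x, and Newton's identity p₂ = e₁² − 2e₂ turns
-- the coefficients of y and y² into tr (A²) and ∑ λ² respectively.

module Submission where

open import Defs
open import Algebra.Bundles using (CommutativeMonoid; CommutativeRing; CommutativeSemiring; Semiring)
import Algebra.Definitions.RawSemiring as RawSemiringDefs
import Algebra.Properties.CommutativeMonoid.Sum as MonoidSum
import Algebra.Properties.CommutativeSemigroup as CommutativeSemigroupProperties
import Algebra.Properties.Monoid.Mult as MonoidMult
import Algebra.Properties.Ring as RingProperties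
import Algebra.Properties.Semiring.Mult as SemiringMult
import Algebra.Properties.Semiring.Sum as SemiringSum
import Algebra.Solver.Ring.NaturalCoefficients.Default as NaturalCoefficients
open import Data.Bool.Base using (true; false; if_then_else_)
open import Data.Empty using (⊥; ⊥-elim)
open import Data.Fin.Base as Fin using (Fin; zero; suc; toℕ; punchIn; punchOut)
open import Data.Fin.Permutation
  using (Permutation′; _⟨$⟩ʳ_; _⟨$⟩ˡ_; inverseˡ; inverseʳ; flip; insert; insert-punchIn; id)
import Data.Fin.Properties as Finₚ
open import Data.Fin.Subset
  using (Subset; inside; outside; _∈_; _∉_; _⊆_; ∣_∣; ⁅_⁆; _∪_; _─_) renaming (_-_ to _∖_)
open import Data.Fin.Subset.Properties
  using (_∈?_; p─⊥≡p; p─q⊆p; x∈p∧x≢y⇒x∈p-y; x∈⁅x⁆; x∈⁅y⁆⇒x≡y; x∈p∪q⁺; x∈p∪q⁻; ⊆-antisym; drop-there)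
open import Data.Integer.Base as ℤ using (ℤ; 0ℤ; 1ℤ; -1ℤ)
import Data.Integer.Properties as ℤₚ
open import Data.List.Base as List
  using (List; []; _∷_; map; foldr; filter; length; lookup; tabulate; allFin; applyUpTo)
open import Data.List.Membership.Propositional using () renaming (_∈_ to _∈ˡ_)
open import Data.List.Membership.Propositional.Properties
  using (∈-lookup; ∈-filter⁺; ∈-filter⁻; ∈-map⁺; ∈-map⁻; ∈-++⁺ˡ; ∈-++⁺ʳ; ∈-allFin)
open import Data.List.Properties using (length-filter; filter-accept; filter-reject)
open import Data.List.Relation.Binary.Pointwise.Base using (Pointwise; []; _∷_)
open import Data.List.Relation.Unary.All as All using (All; []; _∷_)
open import Data.List.Relation.Unary.AllPairs using (AllPairs; []; _∷_)
import Data.List.Relation.Unary.AllPairs.Properties as AllPairsₚ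
open import Data.List.Relation.Unary.Any as Any using (index)
open import Data.List.Relation.Unary.Any.Properties using (lookup-index)
open import Data.List.Relation.Unary.Unique.Propositional using (Unique)
import Data.List.Relation.Unary.Unique.Propositional.Properties as Uniqueₚ
open import Data.Nat.Base as ℕ using (ℕ; zero; suc; _≥_; z≤n; s≤s)
import Data.Nat.ListAction as ListAction
import Data.Nat.Properties as ℕₚ
open import Data.Product.Base using (Σ; _×_; _,_; proj₁; proj₂; ∃-syntax; swap)
open import Data.Sum.Base using (_⊎_; inj₁; inj₂)
open import Data.Vec.Base using ([]; _∷_; here; there)
import Data.Vec.Properties as Vecₚ
open import Function.Base using (_∘_)
open import Function.Bundles using (Equivalence; _⇔_; mk⇔)
open import Level using (Level; _⊔_)
open import Relation.Binary.Definitions using (tri<; tri≈; tri>)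
open import Relation.Binary.PropositionalEquality as ≡ using (_≡_; _≢_; module ≡-Reasoning)
open import Relation.Binary.Structures using (IsStrictPartialOrder)
open import Relation.Nullary.Decidable
  using (Dec; yes; no; does; map′; _×-dec_; ¬?; dec-true; dec-false)
open import Relation.Nullary.Negation using (¬_; contradiction)
open import Relation.Unary using (Pred; Decidable)

-- The two polynomials in `y` are known to agree only where `y` is invertible, and in a Heyting
-- field it cannot be decided whether an element is zero, so neither the value at `y = 0` nor a
-- count of roots is at hand. Coefficients are recovered by the dilation `y ↦ 2y`: passing to
-- `p(2y) − p(y)` removes the constant term and multiplies the coefficient of `yⁱ` by the unit
-- `2ⁱ − 1`. For this, the functions compared must come with coefficient lists.
--
-- The minima arise because `(dᵀ_r)²` counts the ordered pairs of vertices whose degrees are both at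
-- least `r`, so that a pair is counted once for each `r` up to the smaller degree.
--
-- Orientations drop out by squaring: distinct facets share at most one ridge, so an off-diagonal
-- Gram entry is 0 or a single product of signs.
--
-- The equality case speaks of facets, shiftedness of all faces. Purity bridges the gap: a face is
-- extended to a facet, the exchange is made there, and the result is cut down again.

private
  variable
    a p q : Level
    m n : ℕ

-- Polynomial functions and determinants near the identity

-- Negative scalars enter as variables (m and e stand for −1 and ±1), so that these are semiring
-- identities: the solver could not decide cancellations in an abstract ring.
module RingIdentities {c ℓ} (R : CommutativeRing c ℓ) where

  open CommutativeRing R
  open NaturalCoefficients commutativeSemiring using (solve; con; _:+_; _:*_; _:=_)

  add-coeff : ∀ c d y u v → c + d + y * (u + v) ≈ (c + y * u) + (d + y * v)
  add-coeff = solve 5 (λ c d y u v → c :+ d :+ y :* (u :+ v) := (c :+ y :* u) :+ (d :+ y :* v)) refl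

  scale-coeff : ∀ a c y u → a * c + y * (a * u) ≈ a * (c + y * u)
  scale-coeff = solve 4 (λ a c y u → a :* c :+ y :* (a :* u) := a :* (c :+ y :* u)) refl

  mul-coeff : ∀ c y u v → c * v + y * (u * v) ≈ (c + y * u) * v
  mul-coeff = solve 4 (λ c y u v → c :* v :+ y :* (u :* v) := (c :+ y :* u) :* v) refl

  trans-quot : ∀ h p u v → (h + p * u) + p * v ≈ h + p * (u + v)
  trans-quot = solve 4 (λ h p u v → (h :+ p :* u) :+ p :* v := h :+ p :* (u :+ v)) refl

  add-quot : ∀ g g′ p u v → (g + p * u) + (g′ + p * v) ≈ (g + g′) + p * (u + v)
  add-quot = solve 5 (λ g g′ p u v → (g :+ p :* u) :+ (g′ :+ p :* v) := (g :+ g′) :+ p :* (u :+ v)) refl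

  mul-expand : ∀ g p u v → (g + p * u) * v ≈ g * v + p * (u * v)
  mul-expand = solve 4 (λ g p u v → (g :+ p :* u) :* v := g :* v :+ p :* (u :* v)) refl

  mul-collect : ∀ g h p u v → g * (h + p * u) + p * v ≈ g * h + p * (v + g * u)
  mul-collect = solve 5 (λ g h p u v → g :* (h :+ p :* u) :+ p :* v := g :* h :+ p :* (v :+ g :* u)) refl

  const-quot : ∀ a g p u → a * (g + p * u) ≈ a * g + p * (a * u)
  const-quot = solve 4 (λ a g p u → a :* (g :+ p :* u) := a :* g :+ p :* (a :* u)) refl

  y-quot : ∀ a g y p u → (y * a) * (g + p * u) ≈ (y * a) * g + (y * p) * (a * u)
  y-quot = solve 5 (λ a g y p u → (y :* a) :* (g :+ p :* u) := (y :* a) :* g :+ (y :* p) :* (a :* u)) refl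

  square-tail : ∀ y s b a → (1# + y * a) * (s * (y * b)) ≈ s * (y * b) + (y * (y * 1#)) * (a * (s * b))
  square-tail = solve 4 (λ y s b a → (con 1 :+ y :* a) :* (s :* (y :* b)) := s :* (y :* b) :+ (y :* (y :* con 1)) :* (a :* (s :* b))) refl

  jet-* : ∀ y c a b → (1# + y * c) * (1# + y * (a + y * b)) ≈
          (1# + y * ((c + a) + y * (b + c * a))) + (y * (y * (y * 1#))) * (c * b)
  jet-* = solve 4 (λ y c a b → (con 1 :+ y :* c) :* (con 1 :+ y :* (a :+ y :* b)) :=
    (con 1 :+ y :* ((c :+ a) :+ y :* (b :+ c :* a))) :+ (y :* (y :* (y :* con 1))) :* (c :* b)) refl

  jet-+ : ∀ y a b s → (1# + y * (a + y * b)) + y * (y * s) ≈ 1# + y * (a + y * (b + s))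
  jet-+ = solve 4 (λ y a b s → (con 1 :+ y :* (a :+ y :* b)) :+ y :* (y :* s) := con 1 :+ y :* (a :+ y :* (b :+ s))) refl

  sign-pair : ∀ m e y u v → (m * e) * ((y * u) * (e * (y * v))) ≈ (e * e) * (y * (y * (m * (u * v))))
  sign-pair = solve 5 (λ m e y u v → (m :* e) :* ((y :* u) :* (e :* (y :* v))) := (e :* e) :* (y :* (y :* (m :* (u :* v))))) refl

  square-* : ∀ x y → (x * y) * (x * y) ≈ (x * x) * (y * y)
  square-* = solve 2 (λ x y → (x :* y) :* (x :* y) := (x :* x) :* (y :* y)) refl

  expand-square : ∀ c a → (c + a) * (c + a) ≈ (c * c + (c * a + c * a)) + a * a
  expand-square = solve 2 (λ c a → (c :+ a) :* (c :+ a) := (c :* c :+ (c :* a :+ c :* a)) :+ a :* a) refl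

  newton-prod : ∀ b c p S → (c * c + (p + p)) + ((b + b) + S) ≈ ((b + p) + (b + p)) + (c * c + S)
  newton-prod = solve 4 (λ b c p S → (c :* c :+ (p :+ p)) :+ ((b :+ b) :+ S) := ((b :+ p) :+ (b :+ p)) :+ (c :* c :+ S)) refl

  newton-det : ∀ b q t s → ((b + q) + (b + q)) + ((t + s) + s) ≈ ((b + (q + s)) + (b + (q + s))) + t
  newton-det = solve 4 (λ b q t s → ((b :+ q) :+ (b :+ q)) :+ ((t :+ s) :+ s) := ((b :+ (q :+ s)) :+ (b :+ (q :+ s))) :+ t) refl

  trace-split : ∀ c s t S → (c * c + s) + (t + S) ≈ ((c * c + S) + s) + t
  trace-split = solve 4 (λ c s t S → (c :* c :+ s) :+ (t :+ S) := ((c :* c :+ S) :+ s) :+ t) refl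

  dilate-step : ∀ t b m c y u v → (t + m) * c + y * ((t * b) * u + m * v) ≈
                t * (c + (b * y) * u) + m * (c + y * v)
  dilate-step = solve 7 (λ t b m c y u v → (t :+ m) :* c :+ y :* ((t :* b) :* u :+ m :* v) :=
    t :* (c :+ (b :* y) :* u) :+ m :* (c :+ y :* v)) refl

  dilate-head : ∀ b m c y u v → (c + (b * y) * u) + m * (c + y * v) ≈ (c + m * c) + y * (b * u + m * v)
  dilate-head = solve 6 (λ b m c y u v → (c :+ (b :* y) :* u) :+ m :* (c :+ y :* v) := (c :+ m :* c) :+ y :* (b :* u :+ m :* v)) refl

  extend-jet : ∀ y a b q → (1# + y * (a + y * b)) + (y * (y * (y * 1#))) * q ≈ 1# + y * (a + y * (b + y * q))
  extend-jet = solve 4 (λ y a b q → (con 1 :+ y :* (a :+ y :* b)) :+ (y :* (y :* (y :* con 1))) :* q := con 1 :+ y :* (a :+ y :* (b :+ y :* q))) refl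

  interchange : ∀ u v x y → (u * v) * (x * y) ≈ (u * x) * (v * y)
  interchange = solve 4 (λ u v x y → (u :* v) :* (x :* y) := (u :* x) :* (v :* y)) refl

  pull-left : ∀ s u a v d → s * ((u * a) * (v * d)) ≈ (u * v) * (s * (a * d))
  pull-left = solve 5 (λ s u a v d → s :* ((u :* a) :* (v :* d)) := (u :* v) :* (s :* (a :* d))) refl

module PolynomialFunctions {c ℓ} (R : CommutativeRing c ℓ) where

  open CommutativeRing R hiding (zero)
  open SemiringSum semiring using (sum; *-distribˡ-sum; ∑-distrib-+; sum-cong-≋)
  open RawSemiringDefs (Semiring.rawSemiring semiring) using (_^_)
  open RingProperties ring using (+-cancelˡ; -‿distribˡ-*; -‿distribʳ-*; -‿involutive; -1*x≈-x)
  open import Relation.Binary.Reasoning.Setoid setoid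
  private module Id = RingIdentities R

  eval : List Carrier → Carrier → Carrier
  eval []       y = 0#
  eval (c ∷ cs) y = c + y * eval cs y

  addCoeffs : List Carrier → List Carrier → List Carrier
  addCoeffs []       ds       = ds
  addCoeffs (c ∷ cs) []       = c ∷ cs
  addCoeffs (c ∷ cs) (d ∷ ds) = c + d ∷ addCoeffs cs ds

  mulCoeffs : List Carrier → List Carrier → List Carrier
  mulCoeffs []       ds = []
  mulCoeffs (c ∷ cs) ds = addCoeffs (map (c *_) ds) (0# ∷ mulCoeffs cs ds)

  eval-add : ∀ cs ds y → eval (addCoeffs cs ds) y ≈ eval cs y + eval ds y
  eval-add []       ds       y = sym (+-identityˡ _)
  eval-add (c ∷ cs) []       y = sym (+-identityʳ _)
  eval-add (c ∷ cs) (d ∷ ds) y = begin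
    c + d + y * eval (addCoeffs cs ds) y     ≈⟨ +-congˡ (*-congˡ (eval-add cs ds y)) ⟩
    c + d + y * (eval cs y + eval ds y)      ≈⟨ Id.add-coeff c d y _ _ ⟩
    (c + y * eval cs y) + (d + y * eval ds y) ∎

  eval-scale : ∀ a cs y → eval (map (a *_) cs) y ≈ a * eval cs y
  eval-scale a []       y = sym (zeroʳ a)
  eval-scale a (c ∷ cs) y =
    trans (+-congˡ (*-congˡ (eval-scale a cs y))) (Id.scale-coeff a c y _)

  eval-mul : ∀ cs ds y → eval (mulCoeffs cs ds) y ≈ eval cs y * eval ds y
  eval-mul []       ds y = sym (zeroˡ _)
  eval-mul (c ∷ cs) ds y = begin
    eval (addCoeffs (map (c *_) ds) (0# ∷ mulCoeffs cs ds)) y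
      ≈⟨ eval-add (map (c *_) ds) _ y ⟩
    eval (map (c *_) ds) y + (0# + y * eval (mulCoeffs cs ds) y)
      ≈⟨ +-cong (eval-scale c ds y) (trans (+-identityˡ _) (*-congˡ (eval-mul cs ds y))) ⟩
    c * eval ds y + y * (eval cs y * eval ds y)
      ≈⟨ Id.mul-coeff c y _ _ ⟩
    (c + y * eval cs y) * eval ds y ∎

  -- Determinants and products are given as functions of `y`; the coefficient list is kept as data,
  -- since agreement of values is turned into agreement of coefficients only at the very end.
  record IsPolynomial (f : Carrier → Carrier) : Set (c ⊔ ℓ) where
    constructor polynomial
    field
      coeffs : List Carrier
      agrees : ∀ y → f y ≈ eval coeffs y

  poly-const : ∀ a → IsPolynomial λ _ → a
  poly-const a = polynomial (a ∷ []) λ y → sym (trans (+-congˡ (zeroʳ y)) (+-identityʳ a))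

  poly-id : IsPolynomial λ y → y
  poly-id = polynomial (0# ∷ 1# ∷ []) λ y → sym (begin
    0# + y * (1# + y * 0#)  ≈⟨ +-identityˡ _ ⟩
    y * (1# + y * 0#)       ≈⟨ *-congˡ (trans (+-congˡ (zeroʳ y)) (+-identityʳ 1#)) ⟩
    y * 1#                  ≈⟨ *-identityʳ y ⟩
    y                       ∎)

  poly-+ : ∀ {f g} → IsPolynomial f → IsPolynomial g → IsPolynomial λ y → f y + g y
  poly-+ (polynomial cs f≈) (polynomial ds g≈) =
    polynomial (addCoeffs cs ds) λ y → trans (+-cong (f≈ y) (g≈ y)) (sym (eval-add cs ds y))

  poly-* : ∀ {f g} → IsPolynomial f → IsPolynomial g → IsPolynomial λ y → f y * g y
  poly-* (polynomial cs f≈) (polynomial ds g≈) =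
    polynomial (mulCoeffs cs ds) λ y → trans (*-cong (f≈ y) (g≈ y)) (sym (eval-mul cs ds y))

  poly-affine : ∀ a b → IsPolynomial λ y → a + y * b
  poly-affine a b = poly-+ (poly-const a) (poly-* poly-id (poly-const b))

  poly-sum : ∀ {m} {f : Fin m → Carrier → Carrier} → (∀ j → IsPolynomial (f j)) →
             IsPolynomial λ y → sum λ j → f j y
  poly-sum {zero}  p = poly-const 0#
  poly-sum {suc m} p = poly-+ (p zero) (poly-sum λ j → p (suc j))

  poly-det : ∀ {N} {M : Matrix (Carrier → Carrier) N N} → (∀ r s → IsPolynomial (M r s)) →
             IsPolynomial λ y → det R λ r s → M r s y
  poly-det {zero}  p = poly-const 1#
  poly-det {suc N} p = poly-sum λ j →
    poly-* (poly-const ((- 1#) ^ toℕ j))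
      (poly-* (p zero j) (poly-det λ r s → p (suc r) (punchIn j s)))

  -- Congruence modulo powers of y

  -- The quotient has to be polynomial: with an arbitrary function as quotient, the equation could
  -- be solved at every invertible `y` for any `f` and `g`.
  record Cong (d : ℕ) (f g : Carrier → Carrier) : Set (c ⊔ ℓ) where
    constructor congruent
    field
      quotient   : Carrier → Carrier
      isPoly     : IsPolynomial quotient
      equation   : ∀ y → f y ≈ g y + y ^ d * quotient y

  ≈⇒Cong : ∀ {d f g} → (∀ y → f y ≈ g y) → Cong d f g
  ≈⇒Cong f≈g = congruent (λ _ → 0#) (poly-const 0#) λ y →
    trans (f≈g y) (sym (trans (+-congˡ (zeroʳ _)) (+-identityʳ _)))

  Cong-trans : ∀ {d f g h} → Cong d f g → Cong d g h → Cong d f h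
  Cong-trans {d} (congruent q p e) (congruent q′ p′ e′) =
    congruent (λ y → q′ y + q y) (poly-+ p′ p) λ y →
      trans (e y) (trans (+-congʳ (e′ y)) (Id.trans-quot _ (y ^ d) _ _))

  Cong-respʳ : ∀ {d f g h} → Cong d f g → (∀ y → g y ≈ h y) → Cong d f h
  Cong-respʳ c g≈h = Cong-trans c (≈⇒Cong g≈h)

  Cong-respˡ : ∀ {d f g h} → (∀ y → f y ≈ g y) → Cong d g h → Cong d f h
  Cong-respˡ f≈g c = Cong-trans (≈⇒Cong f≈g) c

  Cong-+ : ∀ {d f g f′ g′} → Cong d f g → Cong d f′ g′ →
           Cong d (λ y → f y + f′ y) (λ y → g y + g′ y)
  Cong-+ {d} (congruent q p e) (congruent q′ p′ e′) =
    congruent (λ y → q y + q′ y) (poly-+ p p′) λ y →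
      trans (+-cong (e y) (e′ y)) (Id.add-quot _ _ (y ^ d) _ _)

  -- The asymmetric hypotheses are what makes the new quotient `q f′ + g q′` polynomial.
  Cong-* : ∀ {d f g f′ g′} → IsPolynomial f′ → IsPolynomial g →
           Cong d f g → Cong d f′ g′ →
           Cong d (λ y → f y * f′ y) (λ y → g y * g′ y)
  Cong-* {d} {f} {g} {f′} {g′} pf′ pg (congruent q p e) (congruent q′ p′ e′) =
    congruent (λ y → q y * f′ y + g y * q′ y) (poly-+ (poly-* p pf′) (poly-* pg p′)) λ y → begin
      f y * f′ y                                           ≈⟨ *-congʳ (e y) ⟩
      (g y + y ^ d * q y) * f′ y                           ≈⟨ Id.mul-expand _ (y ^ d) _ _ ⟩
      g y * f′ y + y ^ d * (q y * f′ y)                    ≈⟨ +-congʳ (*-congˡ (e′ y)) ⟩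
      g y * (g′ y + y ^ d * q′ y) + y ^ d * (q y * f′ y)   ≈⟨ Id.mul-collect _ _ (y ^ d) _ _ ⟩
      g y * g′ y + y ^ d * (q y * f′ y + g y * q′ y)       ∎

  Cong-const* : ∀ {d f g} a → Cong d f g → Cong d (λ y → a * f y) (λ y → a * g y)
  Cong-const* {d} a (congruent q p e) =
    congruent (λ y → a * q y) (poly-* (poly-const a) p) λ y →
      trans (*-congˡ (e y)) (Id.const-quot a _ (y ^ d) _)

  -- An explicit factor `y` raises the precision by one. In this way minors known modulo `y` give
  -- terms modulo `y²`, and those known modulo `y²` give terms modulo `y³`.
  Cong-y* : ∀ {d f g} a → Cong d f g →
            Cong (suc d) (λ y → (y * a) * f y) (λ y → (y * a) * g y)
  Cong-y* {d} a (congruent q p e) =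
    congruent (λ y → a * q y) (poly-* (poly-const a) p) λ y →
      trans (*-congˡ (e y)) (Id.y-quot a _ y (y ^ d) _)

  Cong-sum : ∀ {d m} {f g : Fin m → Carrier → Carrier} → (∀ j → Cong d (f j) (g j)) →
             Cong d (λ y → sum λ j → f j y) (λ y → sum λ j → g j y)
  Cong-sum {m = zero}  c = ≈⇒Cong λ _ → refl
  Cong-sum {m = suc m} c = Cong-+ (c zero) (Cong-sum λ j → c (suc j))

  sum-zero : ∀ {m} {f : Fin m → Carrier} → (∀ j → f j ≈ 0#) → sum f ≈ 0#
  sum-zero {zero}  z = refl
  sum-zero {suc m} z = trans (+-cong (z zero) (sum-zero λ j → z (suc j))) (+-identityˡ 0#)

  Cong-sum-0 : ∀ {d m} {f : Fin m → Carrier → Carrier} → (∀ j → Cong d (f j) (λ _ → 0#)) →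
               Cong d (λ y → sum λ j → f j y) (λ _ → 0#)
  Cong-sum-0 {m = m} c = Cong-respʳ (Cong-sum c) λ _ → sum-zero {m} λ _ → refl

  Cong-const*-0 : ∀ {d f} a → Cong d f (λ _ → 0#) → Cong d (λ y → a * f y) (λ _ → 0#)
  Cong-const*-0 a c = Cong-respʳ (Cong-const* a c) λ _ → zeroʳ a

  Cong-0*ˡ : ∀ {d f f′} → IsPolynomial f′ → Cong d f (λ _ → 0#) →
             Cong d (λ y → f y * f′ y) (λ _ → 0#)
  Cong-0*ˡ pf′ c = Cong-respʳ (Cong-* pf′ (poly-const 0#) c (≈⇒Cong λ _ → refl)) λ _ → zeroˡ _

  Cong-0*ʳ : ∀ {d f f′} → IsPolynomial f → Cong d f′ (λ _ → 0#) →
             Cong d (λ y → f y * f′ y) (λ _ → 0#)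
  Cong-0*ʳ pf c = Cong-respˡ (λ _ → *-comm _ _) (Cong-0*ˡ pf c)

  Cong-y : ∀ a → Cong 1 (λ y → y * a) (λ _ → 0#)
  Cong-y a = congruent (λ _ → a) (poly-const a) λ y → sym
    (trans (+-identityˡ _) (*-congʳ (*-identityʳ y)))

  -- The index s only witnesses that the matrix is not 0 × 0.
  det-zeroColumn : ∀ {N} {M : Matrix (Carrier → Carrier) N N} (s : Fin N) →
    (∀ r s → IsPolynomial (M r s)) →
    (∀ r s → toℕ s ≡ 0 → Cong 1 (M r s) (λ _ → 0#)) →
    Cong 1 (λ y → det R λ r s → M r s y) (λ _ → 0#)
  det-zeroColumn {suc N} {M} _ p z = Cong-sum-0 λ j →
    Cong-0*ʳ (poly-const ((- 1#) ^ toℕ j)) (entry j)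
    where
    minor : Fin (suc N) → Matrix (Carrier → Carrier) N N
    minor j r s = M (suc r) (punchIn j s)
    pminor : ∀ j r s → IsPolynomial (minor j r s)
    pminor j r s = p (suc r) (punchIn j s)
    entry : ∀ j → Cong 1 (λ y → M zero j y * det R (λ r s → minor j r s y)) (λ _ → 0#)
    entry zero    = Cong-0*ˡ (poly-det (pminor zero)) (z zero zero ≡.refl)
    entry (suc j) = Cong-0*ʳ (p zero (suc j))
      (det-zeroColumn {M = minor (suc j)} j (pminor (suc j))
        λ { r zero _ → z (suc r) zero ≡.refl })

  -- The expansion of det (I + yA) to second order

  δ : ∀ {N} → Matrix Carrier N N
  δ = scalarMatrix R 1#

  perturbed : ∀ {N} → Matrix Carrier N N → Matrix (Carrier → Carrier) N N
  perturbed A r s y = δ r s + y * A r s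

  det-perturbed-mod¹ : ∀ {N} (A : Matrix Carrier N N) →
    Cong 1 (λ y → det R λ r s → perturbed A r s y) (λ _ → 1#)
  det-perturbed-mod¹ {zero}  A = ≈⇒Cong λ _ → refl
  det-perturbed-mod¹ {suc N} A = Cong-respʳ (Cong-+
    (Cong-const* 1# (Cong-* (poly-det pminor) (poly-const 1#)
      (Cong-respʳ (Cong-+ (≈⇒Cong λ _ → refl) (Cong-y _)) λ _ → +-identityʳ 1#)
      (det-perturbed-mod¹ λ r s → A (suc r) (suc s))))
    (Cong-sum-0 λ j → Cong-const*-0 ((- 1#) ^ suc (toℕ j)) (Cong-0*ˡ
      (poly-det λ r s → poly-affine (δ (suc r) (punchIn (suc j) s)) (A (suc r) (punchIn (suc j) s)))
      (Cong-respʳ (Cong-+ (≈⇒Cong λ _ → refl) (Cong-y _)) λ _ → +-identityʳ 0#))))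
    λ _ → trans (+-identityʳ _) (trans (*-identityˡ _) (*-identityˡ 1#))
    where
    pminor : ∀ r s → IsPolynomial (perturbed (λ r s → A (suc r) (suc s)) r s)
    pminor r s = poly-affine _ _

  det-cong : ∀ {N} {M M′ : Matrix Carrier N N} → (∀ r s → M r s ≈ M′ r s) → det R M ≈ det R M′
  det-cong {zero}  e = refl
  det-cong {suc N} e = sum-cong-≋ λ j →
    *-congˡ {(- 1#) ^ toℕ j} (*-cong (e zero j) (det-cong λ r s → e (suc r) (punchIn j s)))

  -- An off-diagonal entry supplies one factor `y`; the cofactor supplies the second as soon as one
  -- of its columns has lost its diagonal 1.
  Cong-sparseTerm : ∀ {D} c a → Cong 1 D (λ _ → 0#) →
    Cong 2 (λ y → c * ((0# + y * a) * D y)) (λ _ → 0#)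
  Cong-sparseTerm c a cong = Cong-const*-0 c
    (Cong-respˡ (λ y → *-congʳ (+-identityˡ _)) (Cong-respʳ (Cong-y* a cong) λ _ → zeroʳ _))

  Cong-entry-0 : ∀ a → Cong 1 (λ y → 0# + y * a) (λ _ → 0#)
  Cong-entry-0 a = Cong-respˡ (λ _ → +-identityˡ _) (Cong-y a)

  -- Rows 1, …, N and all columns but j + 1 of the identity plus y A, the rows of A being
  -- numbered from 1.
  offDiagonalMinor : ∀ {N} → Matrix Carrier (suc N) (suc (suc N)) → Fin (suc N) →
                     Matrix (Carrier → Carrier) (suc N) (suc N)
  offDiagonalMinor A j r s y = δ (suc r) (punchIn (suc j) s) + y * A r (punchIn (suc j) s)

  poly-entry : ∀ {N} (A : Matrix Carrier N (suc N)) r s → IsPolynomial λ y → δ (suc r) s + y * A r s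
  poly-entry A r s = poly-affine (δ (suc r) s) (A r s)

  -- Column 0 of this minor contains no diagonal 1, and neither does row `j`. Modulo `y²` a term
  -- survives only if both defects are met by one entry, `y * A j zero`, with diagonal 1's
  -- everywhere else; the sign is that of position `(j, 0)`.
  det-offDiagonalMinor : ∀ {N} (A : Matrix Carrier (suc N) (suc (suc N))) j →
    Cong 2 (λ y → det R λ r s → offDiagonalMinor A j r s y)
           (λ y → (- 1#) ^ toℕ j * (y * A j zero))
  det-offDiagonalMinor {N} A zero = Cong-respʳ
    (Cong-+
      (Cong-const* 1# (Cong-respˡ (λ y → *-congʳ (+-identityˡ _))
        (Cong-y* (A zero zero) (det-perturbed-mod¹ λ r s → A (suc r) (suc (suc s))))))
      (Cong-sum-0 λ s → Cong-sparseTerm ((- 1#) ^ suc (toℕ s)) (A zero (punchIn (suc zero) (suc s)))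
        (det-zeroColumn s (λ r t → poly-entry A (suc r) (punchIn (suc zero) (punchIn (suc s) t)))
          λ { r zero _ → Cong-entry-0 (A (suc r) zero) })))
    λ y → trans (+-identityʳ _) (*-congˡ (*-identityʳ _))
  det-offDiagonalMinor {suc N} A (suc j) = Cong-respʳ
    (Cong-+
      -- With the first row deleted, the column that had its diagonal 1 there is divisible by `y`,
      -- and it is now the leading column of the cofactor.
      (Cong-sparseTerm 1# (A zero zero)
        (det-zeroColumn zero (λ r t → poly-entry A (suc r) (punchIn (suc (suc j)) (suc t)))
          λ { r zero _ → Cong-entry-0 (A (suc r) (suc zero)) }))
      (Cong-+
        -- The entry with the diagonal 1: deleting its row and column leaves a minor of the same
        -- kind for `A′`, at index `j`, and the sign changes once.
        (Cong-const* (- 1# * 1#) main)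
        (Cong-sum-0 λ t → Cong-sparseTerm ((- 1#) ^ suc (suc (toℕ t))) (A zero (punchIn (suc (suc j)) (suc (suc t))))
          (det-zeroColumn zero (λ r u → poly-entry A (suc r) (punchIn (suc (suc j)) (punchIn (suc (suc t)) u)))
            λ { r zero _ → Cong-entry-0 (A (suc r) zero) }))))
    λ y → trans (+-identityˡ _) (trans (+-identityʳ _)
      (trans (sym (*-assoc _ _ _)) (*-congʳ (*-congʳ (*-identityʳ _)))))
    where
    A′ : Matrix Carrier (suc N) (suc (suc N))
    A′ r s = A (suc r) (punchIn (suc zero) s)
    e : Carrier
    e = (- 1#) ^ toℕ j
    inner : Carrier → Matrix Carrier (suc N) (suc N)
    inner y r t = let s = punchIn (suc (suc j)) (punchIn (suc zero) t) in
      δ (suc (suc r)) s + y * A (suc r) s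
    inner≈ : ∀ y r t → inner y r t ≈ offDiagonalMinor A′ j r t y
    inner≈ y r zero    = refl
    inner≈ y r (suc t) = refl
    inner-poly : ∀ r t → IsPolynomial λ y → inner y r t
    inner-poly r t = poly-entry A (suc r) (punchIn (suc (suc j)) (punchIn (suc zero) t))
    main : Cong 2 (λ y → (1# + y * A zero (suc zero)) * det R (inner y))
                  (λ y → e * (y * A (suc j) zero))
    main = Cong-trans
      (Cong-* (poly-det inner-poly) (poly-affine 1# (A zero (suc zero))) (≈⇒Cong λ _ → refl)
        (Cong-respˡ (λ y → det-cong (inner≈ y)) (det-offDiagonalMinor A′ j)))
      -- The determinant is already divisible by `y` modulo `y²`, so the factor
      -- `1 + y * A zero (suc zero)` acts as 1.
      (congruent (λ _ → A zero (suc zero) * (e * A (suc j) zero)) (poly-const _) λ y →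
        Id.square-tail y e _ _)

  jet : Carrier → Carrier → Carrier → Carrier
  jet a b y = 1# + y * (a + y * b)

  -- The linear and quadratic coefficients of ∏ (1 + λ y) are the elementary symmetric functions
  -- e₁ and e₂ of the λ's, and Newton's identity recovers the power sum p₂ = e₁² − 2 e₂.
  record Jet (f : Carrier → Carrier) (p₂ : Carrier) : Set (c ⊔ ℓ) where
    constructor mkJet
    field
      linear    : Carrier
      quadratic : Carrier
      expansion : Cong 3 f (jet linear quadratic)
      newton    : linear * linear ≈ (quadratic + quadratic) + p₂

  Cong-jet-* : ∀ {f c a b} → IsPolynomial f → Cong 3 f (jet a b) →
    Cong 3 (λ y → (1# + y * c) * f y) (jet (c + a) (b + c * a))
  Cong-jet-* {c = c} {a} {b} pf cong = Cong-trans
    (Cong-* pf (poly-affine 1# c) (≈⇒Cong λ _ → refl) cong)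
    (congruent (λ _ → c * b) (poly-const _) λ y → Id.jet-* y c a b)

  ∏ : List Carrier → Carrier
  ∏ = foldr _*_ 1#

  ∑² : List Carrier → Carrier
  ∑² xs = foldr _+_ 0# (map (λ x → x * x) xs)

  poly-∏ : ∀ cs → IsPolynomial λ y → ∏ (map (λ c → 1# + y * c) cs)
  poly-∏ []       = poly-const 1#
  poly-∏ (c ∷ cs) = poly-* (poly-affine 1# c) (poly-∏ cs)

  jet-∏ : ∀ cs → Jet (λ y → ∏ (map (λ c → 1# + y * c) cs)) (∑² cs)
  jet-∏ []       = mkJet 0# 0#
    (≈⇒Cong λ y → sym (trans (+-congˡ (trans (*-congˡ (trans (+-identityˡ _) (zeroʳ y))) (zeroʳ y)))
      (+-identityʳ 1#)))
    (trans (zeroˡ 0#) (sym (trans (+-identityʳ _) (+-identityʳ 0#))))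
  jet-∏ (c ∷ cs) with mkJet a b exp newton ← jet-∏ cs =
    mkJet (c + a) (b + c * a) (Cong-jet-* (poly-∏ cs) exp)
      (trans (Id.expand-square c a) (trans (+-congˡ newton) (Id.newton-prod b c (c * a) _)))

  -1² : - 1# * - 1# ≈ 1#
  -1² = trans (-1*x≈-x (- 1#)) (-‿involutive 1#)

  sign² : ∀ m → ((- 1#) ^ m) * ((- 1#) ^ m) ≈ 1#
  sign² zero    = *-identityˡ 1#
  sign² (suc m) = trans (Id.square-* (- 1#) ((- 1#) ^ m)) (trans (*-cong -1² (sign² m)) (*-identityˡ 1#))

  ∑∑ : ∀ {m n} → Matrix Carrier m n → Carrier
  ∑∑ A = sum λ i → sum λ j → A i j

  trace² : ∀ {N} → Matrix Carrier N N → Carrier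
  trace² A = ∑∑ λ i j → A i j * A j i

  -- Expansion along the first row: the diagonal term multiplies the smaller jet by `1 + y c₀`, and
  -- the term of column `j + 1` is `−y²` times the product of the two mirrored off-diagonal entries,
  -- its two signs cancelling up to that -1. Thus `e₂` becomes `b + c₀ a − s`, while the trace of
  -- the square gains `c₀² + 2s`, which keeps Newton's identity intact.
  jet-det : ∀ {N} (A : Matrix Carrier N N) → Jet (λ y → det R λ r s → perturbed A r s y) (trace² A)
  jet-det {zero}  A = jet-∏ []
  jet-det {suc N} A with mkJet a b exp newton ← jet-det (λ r s → A (suc r) (suc s)) =
    mkJet (c₀ + a) ((b + c₀ * a) + - 1# * s) expansion newton′
    where
    c₀ : Carrier
    c₀ = A zero zero
    s : Carrier
    s = sum λ j → A zero (suc j) * A (suc j) zero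
    S : Carrier
    S = trace² λ r s → A (suc r) (suc s)
    -- Stated for every size, so that a column index `j : Fin N` lets `N` be matched as a successor,
    -- the shape required by `det-offDiagonalMinor`.
    tailTerm : ∀ {N} (A : Matrix Carrier (suc N) (suc N)) (j : Fin N) →
      Cong 3 (λ y → ((- 1#) ^ suc (toℕ j)) * ((0# + y * A zero (suc j)) *
                det R (λ r t → perturbed A (suc r) (punchIn (suc j) t) y)))
             (λ y → y * (y * (- 1# * (A zero (suc j) * A (suc j) zero))))
    tailTerm {suc N} A j = Cong-respʳ
      (Cong-const* ((- 1#) ^ suc (toℕ j)) (Cong-respˡ (λ y → *-congʳ (+-identityˡ _))
        (Cong-y* (A zero (suc j)) (det-offDiagonalMinor (λ r t → A (suc r) t) j))))
      λ y → trans (Id.sign-pair (- 1#) ((- 1#) ^ toℕ j) y _ _)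
        (trans (*-congʳ (sign² (toℕ j))) (*-identityˡ _))
    expansion : Cong 3 (λ y → det R λ r s → perturbed A r s y) (jet (c₀ + a) ((b + c₀ * a) + - 1# * s))
    expansion = Cong-respʳ
      (Cong-+
        (Cong-respˡ (λ y → *-identityˡ _)
          (Cong-jet-* (poly-det λ r t → poly-affine (δ r t) (A (suc r) (suc t))) exp))
        (Cong-sum (tailTerm A)))
      λ y → trans (+-congˡ (pull y)) (Id.jet-+ y _ _ _)
      where
      term : Fin N → Carrier
      term j = A zero (suc j) * A (suc j) zero
      pull : ∀ y → (sum λ j → y * (y * (- 1# * term j))) ≈ y * (y * (- 1# * s))
      pull y = sym (trans (*-congˡ (trans (*-congˡ (*-distribˡ-sum (- 1#) term))
                 (*-distribˡ-sum y λ j → - 1# * term j)))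
                 (*-distribˡ-sum y λ j → y * (- 1# * term j)))
    cancel : ∀ x → x + (s + - 1# * s) ≈ x
    cancel x = trans (+-congˡ (trans (+-congˡ (-1*x≈-x s)) (-‿inverseʳ s))) (+-identityʳ x)
    trace-eq : trace² A ≈ ((c₀ * c₀ + S) + s) + s
    trace-eq = trans (+-congˡ (trans
        (∑-distrib-+ (λ i → A (suc i) zero * A zero (suc i)) (λ i → sum λ j → A (suc i) (suc j) * A (suc j) (suc i)))
        (+-congʳ (sum-cong-≋ λ i → *-comm (A (suc i) zero) (A zero (suc i))))))
      (Id.trace-split c₀ s s S)
    newton′ : (c₀ + a) * (c₀ + a) ≈ (((b + c₀ * a) + - 1# * s) + ((b + c₀ * a) + - 1# * s)) + trace² A
    newton′ = begin
      (c₀ + a) * (c₀ + a)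
        ≈⟨ Id.expand-square c₀ a ⟩
      (c₀ * c₀ + (c₀ * a + c₀ * a)) + a * a
        ≈⟨ +-congˡ newton ⟩
      (c₀ * c₀ + (c₀ * a + c₀ * a)) + ((b + b) + S)
        ≈⟨ Id.newton-prod b c₀ (c₀ * a) S ⟩
      ((b + c₀ * a) + (b + c₀ * a)) + (c₀ * c₀ + S)
        ≈⟨ cancel₂ _ _ ⟨
      ((((b + c₀ * a) + - 1# * s) + ((b + c₀ * a) + - 1# * s))) + (((c₀ * c₀ + S) + s) + s)
        ≈⟨ +-congˡ trace-eq ⟨
      (((b + c₀ * a) + - 1# * s) + ((b + c₀ * a) + - 1# * s)) + trace² A ∎
      where
      cancel₂ : ∀ u t → ((u + - 1# * s) + (u + - 1# * s)) + ((t + s) + s) ≈ (u + u) + t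
      cancel₂ u t = trans (Id.newton-det u (- 1# * s) t s)
        (+-congʳ (+-cong drop drop))
        where
        drop : u + (- 1# * s + s) ≈ u
        drop = trans (+-congˡ (+-comm _ _)) (cancel u)

  -- Coefficients determined by the values at units

  Unit : Carrier → Set (c ⊔ ℓ)
  Unit y = ∃[ z ] y * z ≈ 1#

  unit-cancel : ∀ {u x} → Unit u → u * x ≈ 0# → x ≈ 0#
  unit-cancel {u} {x} (v , uv≈1) ux≈0 = begin
    x            ≈⟨ *-identityˡ x ⟨
    1# * x       ≈⟨ *-congʳ (trans (*-comm v u) uv≈1) ⟨
    v * u * x    ≈⟨ *-assoc v u x ⟩
    v * (u * x)  ≈⟨ *-congˡ ux≈0 ⟩
    v * 0#       ≈⟨ zeroʳ v ⟩
    0#           ∎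

  unit-* : ∀ {x y} → Unit x → Unit y → Unit (x * y)
  unit-* (x′ , xx′) (y′ , yy′) =
    x′ * y′ , trans (Id.interchange _ _ x′ y′) (trans (*-cong xx′ yy′) (*-identityˡ 1#))

  x-x≈0 : ∀ x → x + - 1# * x ≈ 0#
  x-x≈0 x = trans (+-congˡ (-1*x≈-x x)) (-‿inverseʳ x)

  x-y≈0⇒x≈y : ∀ {x y} → x + - 1# * y ≈ 0# → x ≈ y
  x-y≈0⇒x≈y {x} {y} e = begin
    x                         ≈⟨ +-identityʳ x ⟨
    x + 0#                    ≈⟨ +-congˡ (trans (+-comm _ _) (x-x≈0 y)) ⟨
    x + (- 1# * y + y)        ≈⟨ +-assoc _ _ _ ⟨
    (x + - 1# * y) + y        ≈⟨ +-congʳ e ⟩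
    0# + y                    ≈⟨ +-identityˡ y ⟩
    y                         ∎

  -- Units stay units under `y ↦ b y`, so vanishing at all units is inherited by dilated
  -- polynomials. As each `bⁱ − 1` is a unit, the dilation loses no information about the
  -- coefficients of positive degree.
  module Vanishing (b : Carrier) (b-unit : Unit b)
                   (bⁱ-1-unit : ∀ i → Unit (b ^ suc i + - 1#)) where

    -- If p vanishes at all units then so does (p(by) − p(y)) / y, of smaller degree.
    dilation : ℕ → List Carrier → List Carrier
    dilation i []       = []
    dilation i (c ∷ cs) = (b ^ suc i + - 1#) * c ∷ dilation (suc i) cs

    -- The list is the tail of a longer polynomial, beginning at degree `i + 1`; this is why a power
    -- of `b` stands before the first evaluation.
    eval-dilation : ∀ i cs y →
      eval (dilation i cs) y ≈ b ^ suc i * eval cs (b * y) + - 1# * eval cs y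
    eval-dilation i []       y = sym (trans (+-cong (zeroʳ _) (zeroʳ _)) (+-identityˡ 0#))
    eval-dilation i (c ∷ cs) y = begin
      (t + - 1#) * c + y * eval (dilation (suc i) cs) y
        ≈⟨ +-congˡ (*-congˡ (trans (eval-dilation (suc i) cs y) (+-congʳ (*-congʳ (*-comm b t))))) ⟩
      (t + - 1#) * c + y * ((t * b) * eval cs (b * y) + - 1# * eval cs y)
        ≈⟨ Id.dilate-step t b (- 1#) c y _ _ ⟩
      t * (c + (b * y) * eval cs (b * y)) + - 1# * (c + y * eval cs y) ∎
      where
      t : Carrier
      t = b ^ suc i

    length-dilation : ∀ i cs → length (dilation i cs) ≡ length cs
    length-dilation i []       = ≡.refl
    length-dilation i (c ∷ cs) = ≡.cong suc (length-dilation (suc i) cs)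

    undilate : ∀ i cs → All (_≈ 0#) (dilation i cs) → All (_≈ 0#) cs
    undilate i []       []       = []
    undilate i (c ∷ cs) (e ∷ es) = unit-cancel (bⁱ-1-unit i) e ∷ undilate (suc i) cs es

    eval-zeros : ∀ {cs} y → All (_≈ 0#) cs → eval cs y ≈ 0#
    eval-zeros y []       = refl
    eval-zeros y (e ∷ es) = trans (+-cong e (trans (*-congˡ (eval-zeros y es)) (zeroʳ y))) (+-identityˡ 0#)

    vanishing : ∀ m cs → length cs ≡ m → (∀ y → Unit y → eval cs y ≈ 0#) → All (_≈ 0#) cs
    vanishing m       []       len z = []
    vanishing (suc m) (c ∷ cs) len z = c≈0 ∷ rest
      where
      rest : All (_≈ 0#) cs
      -- The tail `cs` begins at degree 1, hence the offset 0. The dilated list is not a sublist of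
      -- the given one, so the recursion runs on the length `m`.
      rest = undilate 0 cs (vanishing m (dilation 0 cs)
        (≡.trans (length-dilation 0 cs) (≡.cong ℕ.pred len)) λ y unit-y →
        unit-cancel unit-y (begin
          y * eval (dilation 0 cs) y
            ≈⟨ *-congˡ (trans (eval-dilation 0 cs y) (+-congʳ (*-congʳ (*-identityʳ b)))) ⟩
          y * (b * eval cs (b * y) + - 1# * eval cs y)
            ≈⟨ +-identityˡ _ ⟨
          0# + y * (b * eval cs (b * y) + - 1# * eval cs y)
            ≈⟨ +-congʳ (x-x≈0 c) ⟨
          (c + - 1# * c) + y * (b * eval cs (b * y) + - 1# * eval cs y)
            ≈⟨ Id.dilate-head b (- 1#) c y _ _ ⟨
          (c + (b * y) * eval cs (b * y)) + - 1# * (c + y * eval cs y)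
            ≈⟨ +-cong (z (b * y) (unit-* b-unit unit-y)) (trans (*-congˡ (z y unit-y)) (zeroʳ _)) ⟩
          0# + 0#
            ≈⟨ +-identityˡ 0# ⟩
          0# ∎))
      c≈0 : c ≈ 0#
      -- Once the tail is zero, any unit will do to read off the constant term.
      c≈0 = begin
        c                     ≈⟨ +-identityʳ c ⟨
        c + 0#                ≈⟨ +-congˡ (trans (*-congˡ (eval-zeros 1# rest)) (zeroʳ 1#)) ⟨
        c + 1# * eval cs 1#   ≈⟨ z 1# (1# , *-identityˡ 1#) ⟩
        0#                    ∎

    jet-eval : ∀ {f a b} → Cong 3 f (jet a b) → Σ (List Carrier) λ cs → ∀ y → f y ≈ eval (1# ∷ a ∷ b ∷ cs) y
    jet-eval (congruent q (polynomial cs q≈) e) = cs , λ y →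
      trans (e y) (trans (+-congˡ (*-congˡ (q≈ y))) (Id.extend-jet y _ _ _))

    differences-vanish : ∀ cs ds → (∀ y → Unit y → eval cs y ≈ eval ds y) →
      All (_≈ 0#) (addCoeffs cs (map (- 1# *_) ds))
    differences-vanish cs ds cs≈ds = vanishing _ (addCoeffs cs (map (- 1# *_) ds)) ≡.refl λ y unit-y → begin
      eval (addCoeffs cs (map (- 1# *_) ds)) y   ≈⟨ eval-add cs (map (- 1# *_) ds) y ⟩
      eval cs y + eval (map (- 1# *_) ds) y      ≈⟨ +-cong (cs≈ds y unit-y) (eval-scale (- 1#) ds y) ⟩
      eval ds y + - 1# * eval ds y               ≈⟨ x-x≈0 (eval ds y) ⟩
      0#                                         ∎

    -- Newton's identity is used in the form `e₁² = 2e₂ + p₂`: equal `e₁` and `e₂` give equal `p₂`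
    -- by cancellation, without a division.
    jet-unique : ∀ {f g p q} → Jet f p → Jet g q → (∀ y → Unit y → f y ≈ g y) → p ≈ q
    jet-unique {f} {g} {p} {q} (mkJet a b exp newton) (mkJet a′ b′ exp′ newton′) f≈g =
      conclude (differences-vanish (1# ∷ a ∷ b ∷ proj₁ F) (1# ∷ a′ ∷ b′ ∷ proj₁ G) λ y unit-y →
        trans (sym (proj₂ F y)) (trans (f≈g y unit-y) (proj₂ G y)))
      where
      F : Σ (List Carrier) λ cs → ∀ y → f y ≈ eval (1# ∷ a ∷ b ∷ cs) y
      F = jet-eval exp
      G : Σ (List Carrier) λ ds → ∀ y → g y ≈ eval (1# ∷ a′ ∷ b′ ∷ ds) y
      G = jet-eval exp′
      conclude : ∀ {z zs} → All (_≈ 0#) (z ∷ a + - 1# * a′ ∷ b + - 1# * b′ ∷ zs) → p ≈ q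
      conclude (_ ∷ a-a′ ∷ b-b′ ∷ _) = +-cancelˡ (b + b) p q (begin
        (b + b) + p      ≈⟨ newton ⟨
        a * a            ≈⟨ *-cong a≈a′ a≈a′ ⟩
        a′ * a′          ≈⟨ newton′ ⟩
        (b′ + b′) + q    ≈⟨ +-congʳ (+-cong b≈b′ b≈b′) ⟨
        (b + b) + q      ∎)
        where
        a≈a′ : a ≈ a′
        a≈a′ = x-y≈0⇒x≈y a-a′
        b≈b′ : b ≈ b′
        b≈b′ = x-y≈0⇒x≈y b-b′

  det-scale : ∀ {N} u (M : Matrix Carrier N N) → det R (λ r s → u * M r s) ≈ u ^ N * det R M
  det-scale {zero}  u M = sym (*-identityˡ 1#)
  det-scale {suc N} u M = trans
    (sum-cong-≋ λ j → trans
      (*-congˡ {(- 1#) ^ toℕ j} (*-congˡ (det-scale u λ r s → M (suc r) (punchIn j s))))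
      (Id.pull-left ((- 1#) ^ toℕ j) u (M zero j) (u ^ N) _))
    (sym (*-distribˡ-sum (u ^ suc N) λ j →
      (- 1#) ^ toℕ j * (M zero j * det R λ r s → M (suc r) (punchIn j s))))

  -- With `u = 1/x`, one factor `u` goes to each linear factor: `x` becomes 1 and `x − c` becomes
  -- `1 − u c`. The zero eigenvalues thereby leave no trace.
  scale-factored : ∀ {u x} → u * x ≈ 1# → ∀ m cs →
    u ^ (m ℕ.+ length cs) * (x ^ m * ∏ (map (λ c → x - c) cs)) ≈ ∏ (map (λ c → 1# + (- u) * c) cs)
  scale-factored {u} {x} ux≈1 zero cs = trans (*-congˡ (*-identityˡ _)) (go cs)
    where
    go : ∀ cs → u ^ length cs * ∏ (map (λ c → x - c) cs) ≈ ∏ (map (λ c → 1# + (- u) * c) cs)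
    go []       = *-identityˡ 1#
    go (c ∷ cs) = trans (Id.interchange u _ (x - c) _) (*-cong (begin
        u * (x - c)          ≈⟨ distribˡ u x (- c) ⟩
        u * x + u * (- c)    ≈⟨ +-cong ux≈1 (trans (sym (-‿distribʳ-* u c)) (-‿distribˡ-* u c)) ⟩
        1# + (- u) * c       ∎) (go cs))
  scale-factored {u} {x} ux≈1 (suc m) cs = trans
    (trans (*-congˡ (*-assoc x _ _)) (Id.interchange u _ x _))
    (trans (*-cong ux≈1 (scale-factored ux≈1 m cs)) (*-identityˡ _))

-- The power sum of a spectrum

module ℕ∑ = SemiringSum ℕₚ.+-*-semiring

module RealSpectrum {c ℓ₁ ℓ₂ ℓ₃} (ℝ : RealNumbers c ℓ₁ ℓ₂ ℓ₃) where

  private module ℝ = RealNumbers ℝ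
  open ℝ using (_<_; _≤_; fromℕ; fromℤ; sumOfSquares; #⇔<; +-monoˡ-<; 0<1; #⇒invertible)
  open CommutativeRing ℝ.commutativeRing hiding (zero)
  open IsStrictPartialOrder ℝ.isStrictPartialOrder
    using (irrefl; <-respˡ-≈) renaming (trans to <-trans)
  open RawSemiringDefs (Semiring.rawSemiring semiring) using (_^_)
  open RingProperties ring using (-‿distribˡ-*; -‿distribʳ-*; -‿involutive; -0#≈0#)
  open SemiringSum semiring using (sum; sum-cong-≋)
  open MonoidMult +-monoid using (×-homo-+)
  open SemiringMult semiring using (×1-homo-*)
  open PolynomialFunctions ℝ.commutativeRing
  open import Relation.Binary.Reasoning.Setoid setoid

  -x*-y≈x*y : ∀ x y → (- x) * (- y) ≈ x * y
  -x*-y≈x*y x y = begin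
    (- x) * (- y)   ≈⟨ -‿distribˡ-* x (- y) ⟨
    - (x * - y)     ≈⟨ -‿cong (-‿distribʳ-* x y) ⟨
    - - (x * y)     ≈⟨ -‿involutive (x * y) ⟩
    x * y           ∎

  fromℕ-suc : ∀ m → fromℕ m < fromℕ (suc m)
  fromℕ-suc m = <-respˡ-≈ (+-identityˡ _) (+-monoˡ-< (fromℕ m) 0<1)

  fromℕ-mono-< : ∀ {m n} → m ℕ.< n → fromℕ m < fromℕ n
  fromℕ-mono-< {m} {suc n} (ℕ.s≤s m≤n) with ℕₚ.m≤n⇒m<n∨m≡n m≤n
  ... | inj₁ m<n    = <-trans (fromℕ-mono-< m<n) (fromℕ-suc n)
  ... | inj₂ ≡.refl = fromℕ-suc m

  fromℕ-mono-≤ : ∀ {m n} → m ℕ.≤ n → fromℕ m ≤ fromℕ n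
  fromℕ-mono-≤ m≤n n<m with ℕₚ.m≤n⇒m<n∨m≡n m≤n
  ... | inj₁ m<n    = irrefl refl (<-trans n<m (fromℕ-mono-< m<n))
  ... | inj₂ ≡.refl = irrefl refl n<m

  fromℕ-injective : ∀ {m n} → fromℕ m ≈ fromℕ n → m ≡ n
  fromℕ-injective {m} {n} e with ℕₚ.<-cmp m n
  ... | tri< m<n _ _ = ⊥-elim (irrefl e (fromℕ-mono-< m<n))
  ... | tri≈ _ m≡n _ = m≡n
  ... | tri> _ _ n<m = ⊥-elim (irrefl (sym e) (fromℕ-mono-< n<m))

  fromℕ-gap-unit : ∀ {m n} → m ℕ.< n → Unit (fromℕ n + - fromℕ m)
  fromℕ-gap-unit m<n with v , _ , e ← #⇒invertible (Equivalence.from #⇔< (inj₂ (fromℕ-mono-< m<n))) = v , e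

  unit-resp : ∀ {x y} → x ≈ y → Unit x → Unit y
  unit-resp x≈y (z , e) = z , trans (*-congʳ (sym x≈y)) e

  fromℕ-^ : ∀ m i → fromℕ (m ℕ.^ i) ≈ fromℕ m ^ i
  fromℕ-^ m zero    = +-identityʳ 1#
  fromℕ-^ m (suc i) = trans (×1-homo-* m (m ℕ.^ i)) (*-congˡ (fromℕ-^ m i))

  -- With `b = 2`, both `b` and every `bⁱ − 1` for `i ≥ 1` are positive integers, hence invertible
  -- in the ordered field.
  open Vanishing (fromℕ 2)
    (unit-resp (trans (+-congˡ -0#≈0#) (+-identityʳ _)) (fromℕ-gap-unit {0} {2} (ℕ.s≤s ℕ.z≤n)))
    (λ i → unit-resp (+-cong (fromℕ-^ 2 (suc i)) (-‿cong (+-identityʳ 1#)))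
      (fromℕ-gap-unit {1} {2 ℕ.^ suc i} (ℕₚ.^-monoʳ-< 2 (ℕ.s≤s (ℕ.s≤s ℕ.z≤n)) {0} {suc i} (ℕ.s≤s ℕ.z≤n))))

  -- The substitution `x = −z = −1/y`: multiplying each row of `xI − A` by `−y` gives `I + yA`.
  charPoly-perturbed : ∀ {N} (A : Matrix ℤ N N) {y z} → y * z ≈ 1# →
    det ℝ.commutativeRing (λ i j → perturbed (λ i j → fromℤ (A i j)) i j y) ≈
    (- y) ^ N * charPoly ℝ A (- z)
  charPoly-perturbed {N} A {y} {z} yz≈1 = trans (det-cong entry)
    (det-scale (- y) λ i j → scalarMatrix ℝ.commutativeRing (- z) i j - fromℤ (A i j))
    where
    entry : ∀ i j → δ i j + y * fromℤ (A i j) ≈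
            (- y) * (scalarMatrix ℝ.commutativeRing (- z) i j + - fromℤ (A i j))
    entry i j = sym (trans (distribˡ (- y) _ _) (+-cong scalar (-x*-y≈x*y y _)))
      where
      scalar : (- y) * scalarMatrix ℝ.commutativeRing (- z) i j ≈ δ i j
      scalar with does (i Finₚ.≟ j)
      ... | true  = trans (-x*-y≈x*y y z) yz≈1
      ... | false = zeroʳ (- y)

  sumOfSquares-spectrum : ∀ {N} (A : Matrix ℤ N N) λs → IsNonzeroSpectrum ℝ A λs →
    sumOfSquares λs ≈ trace² λ i j → fromℤ (A i j)
  sumOfSquares-spectrum {N} A λs spectrum = jet-unique (jet-∏ λs) (jet-det λ i j → fromℤ (A i j)) agree
    where
    open IsNonzeroSpectrum spectrum
    agree : ∀ y → Unit y → ∏ (map (λ l → 1# + y * l) λs) ≈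
                           det ℝ.commutativeRing (λ i j → perturbed (λ i j → fromℤ (A i j)) i j y)
    agree y (z , yz≈1) = sym (begin
      det ℝ.commutativeRing (λ i j → perturbed (λ i j → fromℤ (A i j)) i j y)
        ≈⟨ charPoly-perturbed A yz≈1 ⟩
      (- y) ^ N * charPoly ℝ A (- z)
        ≈⟨ *-cong (reflexive (≡.cong ((- y) ^_) (≡.sym size))) (charPoly-eq (- z)) ⟩
      (- y) ^ (nullity ℕ.+ length λs) * ((- z) ^ nullity * ∏ (map (λ l → (- z) - l) λs))
        ≈⟨ scale-factored (trans (-x*-y≈x*y y z) yz≈1) nullity λs ⟩
      ∏ (map (λ l → 1# + (- - y) * l) λs)
        ≈⟨ ∏-cong λs ⟩
      ∏ (map (λ l → 1# + y * l) λs) ∎)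
      where
      ∏-cong : ∀ cs → ∏ (map (λ l → 1# + (- - y) * l) cs) ≈ ∏ (map (λ l → 1# + y * l) cs)
      ∏-cong []       = refl
      ∏-cong (c ∷ cs) = *-cong (+-congˡ (*-congʳ (-‿involutive y))) (∏-cong cs)

  fromℤ-square : ∀ i → fromℤ i * fromℤ i ≈ fromℕ (ℤ.∣ i ∣ ℕ.* ℤ.∣ i ∣)
  fromℤ-square (ℤ.+ m)      = sym (×1-homo-* m m)
  fromℤ-square ℤ.-[1+ m ] = trans (-x*-y≈x*y _ _) (sym (×1-homo-* (suc m) (suc m)))

  fromℕ-sum : ∀ {m} (f : Fin m → ℕ) → fromℕ (ℕ∑.sum f) ≈ sum λ i → fromℕ (f i)
  fromℕ-sum {zero}  f = refl
  fromℕ-sum {suc m} f = trans (×-homo-+ 1# (f zero) _) (+-congˡ (fromℕ-sum λ i → f (suc i)))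

  -- By symmetry every term is the square of an integer, so the whole trace is the image of a
  -- natural number; from here on the inequality and its equality case are questions about `ℕ`.
  trace²-fromℤ : ∀ {N} (A : Matrix ℤ N N) → (∀ i j → A i j ≡ A j i) →
    trace² (λ i j → fromℤ (A i j)) ≈ fromℕ (ℕ∑.sum λ i → ℕ∑.sum λ j → ℤ.∣ A i j ∣ ℕ.* ℤ.∣ A i j ∣)
  trace²-fromℤ A symmetric = sym (trans
    (fromℕ-sum λ i → ℕ∑.sum λ j → ℤ.∣ A i j ∣ ℕ.* ℤ.∣ A i j ∣)
    (sum-cong-≋ λ i → trans (fromℕ-sum λ j → ℤ.∣ A i j ∣ ℕ.* ℤ.∣ A i j ∣)
      (sum-cong-≋ λ j → trans (sym (fromℤ-square (A i j)))
        (*-congˡ (reflexive (≡.cong fromℤ (symmetric i j)))))))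

-- Sums of indicators

open import Data.Nat.Base using (_+_; _*_; _≤_; _⊓_)
open ≡ using (refl; sym; trans; cong; cong₂; subst; subst₂)

module _ {c ℓ} (M : CommutativeMonoid c ℓ) where
  open CommutativeMonoid M using (Carrier; _≈_; ε; ∙-congˡ; ∙-cong; identityˡ; identityʳ)
    renaming (refl to ≈-refl; trans to ≈-trans)
  open MonoidSum M using (sum; sum-cong-≋; ∑-comm)

  ∑⁴-comm : ∀ {m n p q} (f : Fin m → Fin n → Fin p → Fin q → Carrier) →
    (sum λ a → sum λ b → sum λ c → sum λ d → f a b c d) ≈
    (sum λ c → sum λ d → sum λ a → sum λ b → f a b c d)
  ∑⁴-comm f =
    ≈-trans (sum-cong-≋ λ a → ∑-comm λ b c → sum λ d → f a b c d)
    (≈-trans (∑-comm λ a c → sum λ b → sum λ d → f a b c d)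
    (≈-trans (sum-cong-≋ λ c → sum-cong-≋ λ a → ∑-comm λ b d → f a b c d)
    (sum-cong-≋ λ c → ∑-comm λ a d → sum λ b → f a b c d)))

  sum-zeros : {f : Fin n → Carrier} → (∀ i → f i ≈ ε) → sum f ≈ ε
  sum-zeros {zero}  z = ≈-refl
  sum-zeros {suc n} z = ≈-trans (∙-cong (z zero) (sum-zeros (z ∘ suc))) (identityˡ ε)

  sum-single : (f : Fin n → Carrier) (i : Fin n) → (∀ j → j ≢ i → f j ≈ ε) → sum f ≈ f i
  sum-single f zero    z = ≈-trans (∙-congˡ (sum-zeros λ j → z (suc j) λ ())) (identityʳ _)
  sum-single f (suc i) z = ≈-trans
    (∙-cong (z zero λ ()) (sum-single (f ∘ suc) i λ j j≢i → z (suc j) (j≢i ∘ Finₚ.suc-injective)))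
    (identityˡ _)

module _ {c ℓ} (R : CommutativeSemiring c ℓ) where
  open CommutativeSemiring R
    using (_≈_; semiring; setoid; +-commutativeMonoid; *-commutativeSemigroup)
    renaming (Carrier to C; _*_ to _⊗_; trans to ≈-trans)
  open SemiringSum semiring using (sum; sum-cong-≋; *-distribˡ-sum; *-distribʳ-sum)
  open CommutativeSemigroupProperties *-commutativeSemigroup using (interchange)

  sum-*-sum : (f : Fin m → C) (g : Fin n → C) →
              sum f ⊗ sum g ≈ sum λ i → sum λ j → f i ⊗ g j
  sum-*-sum f g = ≈-trans (*-distribʳ-sum (sum g) f) (sum-cong-≋ λ i → *-distribˡ-sum (f i) g)

  -- Both sides are the fourfold sum of `B i l`, `B j l`, `B i l′`, `B j l′` multiplied together,
  -- with the factors grouped by columns or by rows.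
  gram-trace² : (B : Matrix C m n) →
    (sum λ i → sum λ j → (sum λ l → B i l ⊗ B j l) ⊗ (sum λ l → B i l ⊗ B j l)) ≈
    (sum λ l → sum λ l′ → (sum λ i → B i l ⊗ B i l′) ⊗ (sum λ i → B i l ⊗ B i l′))
  gram-trace² B = begin
    (sum λ i → sum λ j → (sum λ l → B i l ⊗ B j l) ⊗ (sum λ l → B i l ⊗ B j l))
      ≈⟨ (sum-cong-≋ λ i → sum-cong-≋ λ j → sum-*-sum (λ l → B i l ⊗ B j l) (λ l → B i l ⊗ B j l)) ⟩
    (sum λ i → sum λ j → sum λ l → sum λ l′ → (B i l ⊗ B j l) ⊗ (B i l′ ⊗ B j l′))
      ≈⟨ (∑⁴-comm +-commutativeMonoid λ i j l l′ → (B i l ⊗ B j l) ⊗ (B i l′ ⊗ B j l′)) ⟩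
    (sum λ l → sum λ l′ → sum λ i → sum λ j → (B i l ⊗ B j l) ⊗ (B i l′ ⊗ B j l′))
      ≈⟨ (sum-cong-≋ λ l → sum-cong-≋ λ l′ → sum-cong-≋ λ i → sum-cong-≋ λ j → interchange (B i l) (B j l) (B i l′) (B j l′)) ⟩
    (sum λ l → sum λ l′ → sum λ i → sum λ j → (B i l ⊗ B i l′) ⊗ (B j l ⊗ B j l′))
      ≈⟨ (sum-cong-≋ λ l → sum-cong-≋ λ l′ → sum-*-sum (λ i → B i l ⊗ B i l′) (λ i → B i l ⊗ B i l′)) ⟨
    (sum λ l → sum λ l′ → (sum λ i → B i l ⊗ B i l′) ⊗ (sum λ i → B i l ⊗ B i l′)) ∎
    where open import Relation.Binary.Reasoning.Setoid setoid

open ℕ∑ using (sum; sum-cong-≗; ∑-comm; ∑-distrib-+; sum-permute)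

𝟙 : {P : Set p} → Dec P → ℕ
𝟙 P? = if does P? then 1 else 0

𝟙-yes : {P : Set p} (P? : Dec P) → P → 𝟙 P? ≡ 1
𝟙-yes P? x = cong (if_then 1 else 0) (dec-true P? x)

𝟙-no : {P : Set p} (P? : Dec P) → ¬ P → 𝟙 P? ≡ 0
𝟙-no P? ¬x = cong (if_then 1 else 0) (dec-false P? ¬x)

𝟙-mono : {P : Set p} {Q : Set q} (P? : Dec P) (Q? : Dec Q) → (P → Q) → 𝟙 P? ≤ 𝟙 Q?
𝟙-mono (no _)  Q? f = z≤n
𝟙-mono (yes x) Q? f = ℕₚ.≤-reflexive (sym (𝟙-yes Q? (f x)))

𝟙-cong : {P : Set p} {Q : Set q} (P? : Dec P) (Q? : Dec Q) → (P → Q) → (Q → P) → 𝟙 P? ≡ 𝟙 Q?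
𝟙-cong P? Q? f g = ℕₚ.≤-antisym (𝟙-mono P? Q? f) (𝟙-mono Q? P? g)

𝟙-× : {P : Set p} {Q : Set q} (P? : Dec P) (Q? : Dec Q) → 𝟙 (P? ×-dec Q?) ≡ 𝟙 P? * 𝟙 Q?
𝟙-× (no _)  Q? = refl
𝟙-× (yes _) Q? = sym (ℕₚ.+-identityʳ _)

𝟙-split : {P : Set p} {Q : Set q} (P? : Dec P) (Q? : Dec Q) →
          𝟙 P? ≡ 𝟙 (P? ×-dec Q?) + 𝟙 (P? ×-dec ¬? Q?)
𝟙-split (no _)  Q?      = refl
𝟙-split (yes _) (no _)  = refl
𝟙-split (yes _) (yes _) = refl

-- The tool for double counting: an indicator becomes a sum over its unique witness, after which the
-- order of summation can be changed.
sum-unique : {P : Set p} {Q : Fin n → Set q} (P? : Dec P) (Q? : ∀ i → Dec (Q i)) →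
  (∀ {i j} → Q i → Q j → i ≡ j) → (P → ∃[ i ] Q i) → (∀ {i} → Q i → P) →
  (sum λ i → 𝟙 (Q? i)) ≡ 𝟙 P?
sum-unique (no ¬x) Q? unique exists only =
  sum-zeros ℕₚ.+-0-commutativeMonoid λ i → 𝟙-no (Q? i) (¬x ∘ only)
sum-unique (yes x) Q? unique exists only with i , y ← exists x = trans
  (sum-single ℕₚ.+-0-commutativeMonoid (λ i → 𝟙 (Q? i)) i λ j j≢i → 𝟙-no (Q? j) λ z → j≢i (unique z y))
  (𝟙-yes (Q? i) y)

sum-mono : {f g : Fin n → ℕ} → (∀ i → f i ≤ g i) → sum f ≤ sum g
sum-mono {zero}  f≤g = z≤n
sum-mono {suc n} f≤g = ℕₚ.+-mono-≤ (f≤g zero) (sum-mono (f≤g ∘ suc))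

+-tight : ∀ {a b c d} → a ≤ c → b ≤ d → a + b ≡ c + d → a ≡ c × b ≡ d
+-tight {a} {b} {c} {d} a≤c b≤d e = a≡c , ℕₚ.+-cancelˡ-≡ a b d (trans e (cong (_+ d) (sym a≡c)))
  where
  a≡c : a ≡ c
  a≡c = ℕₚ.≤-antisym a≤c (ℕₚ.+-cancelʳ-≤ b c a
    (ℕₚ.≤-trans (ℕₚ.+-monoʳ-≤ c b≤d) (ℕₚ.≤-reflexive (sym e))))

sum-tight : {f g : Fin n → ℕ} → (∀ i → f i ≤ g i) → sum f ≡ sum g → ∀ i → f i ≡ g i
sum-tight f≤g e zero    = proj₁ (+-tight (f≤g zero) (sum-mono (f≤g ∘ suc)) e)
sum-tight f≤g e (suc i) = sum-tight (f≤g ∘ suc) (proj₂ (+-tight (f≤g zero) (sum-mono (f≤g ∘ suc)) e)) i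

count-lookup : {A : Set a} {P : Pred A p} (P? : Decidable P) (xs : List A) →
  length (filter P? xs) ≡ sum λ l → 𝟙 (P? (lookup xs l))
count-lookup P? []       = refl
count-lookup P? (x ∷ xs) with does (P? x)
... | true  = cong suc (count-lookup P? xs)
... | false = count-lookup P? xs

count-tabulate : {A : Set a} {P : Pred A p} (P? : Decidable P) (f : Fin n → A) →
  length (filter P? (tabulate f)) ≡ sum λ i → 𝟙 (P? (f i))
count-tabulate {n = zero}  P? f = refl
count-tabulate {n = suc n} P? f with does (P? (f zero))
... | true  = cong suc (count-tabulate P? (f ∘ suc))
... | false = count-tabulate P? (f ∘ suc)

sum-applyUpTo : ∀ (f g : ℕ → ℕ) m → ListAction.sum (map f (applyUpTo g m)) ≡ sum λ (r : Fin m) → f (g (toℕ r))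
sum-applyUpTo f g zero    = refl
sum-applyUpTo f g (suc m) = cong (f (g 0) +_) (sum-applyUpTo f (g ∘ suc) m)

sum-thresholds : ∀ m {x} → x ≤ m → (sum λ (r : Fin m) → 𝟙 (suc (toℕ r) ℕₚ.≤? x)) ≡ x
sum-thresholds zero    z≤n = refl
sum-thresholds (suc m) {zero}  _ = sum-zeros ℕₚ.+-0-commutativeMonoid {suc m} λ r →
  𝟙-no (suc (toℕ r) ℕₚ.≤? 0) λ ()
sum-thresholds (suc m) {suc x} (s≤s x≤m) = cong₂ _+_ (𝟙-yes (1 ℕₚ.≤? suc x) (s≤s z≤n))
  (trans (sum-cong-≗ {m} λ r → 𝟙-cong (suc (suc (toℕ r)) ℕₚ.≤? suc x) (suc (toℕ r) ℕₚ.≤? x) ℕ.s≤s⁻¹ s≤s)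
    (sum-thresholds m x≤m))

sum-membership : (S : Subset n) → (sum λ v → 𝟙 (v ∈? S)) ≡ ∣ S ∣
sum-membership []            = refl
sum-membership (inside  ∷ S) = cong suc (trans
  (sum-cong-≗ λ v → 𝟙-cong (suc v ∈? inside ∷ S) (v ∈? S) drop-there there) (sum-membership S))
sum-membership (outside ∷ S) = trans
  (sum-cong-≗ λ v → 𝟙-cong (suc v ∈? outside ∷ S) (v ∈? S) drop-there there) (sum-membership S)

-- Exchanging vertices of a set

x∈p─q⇒x∉q : (p q : Subset n) {x : Fin n} → x ∈ p ─ q → x ∉ q
x∈p─q⇒x∉q (_ ∷ p) (_ ∷ q) (there x∈p─q) (there x∈q) = x∈p─q⇒x∉q p q x∈p─q x∈q
x∈p─q⇒x∉q (outside ∷ p) (inside ∷ q) () here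
x∈p─q⇒x∉q (inside  ∷ p) (inside ∷ q) () here

x∉p-x : (p : Subset n) {x : Fin n} → x ∉ p ∖ x
x∉p-x p {x} x∈ = x∈p─q⇒x∉q p ⁅ x ⁆ x∈ (x∈⁅x⁆ x)

∈-∖⁻ : (p : Subset n) {x y : Fin n} → x ∈ p ∖ y → x ∈ p × x ≢ y
∈-∖⁻ p {x} {y} x∈ = p─q⊆p p ⁅ y ⁆ x∈ , λ { refl → x∉p-x p x∈ }

∣p-x∣ : (p : Subset n) {x : Fin n} → x ∈ p → suc ∣ p ∖ x ∣ ≡ ∣ p ∣
∣p-x∣ (inside  ∷ p) {zero}  here = cong (suc ∘ ∣_∣) (p─⊥≡p p)
∣p-x∣ (inside  ∷ p) {suc x} (there x∈p) = cong suc (∣p-x∣ p x∈p)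
∣p-x∣ (outside ∷ p) {suc x} (there x∈p) = ∣p-x∣ p x∈p

∖-cancel : {p q : Subset n} {x : Fin n} → x ∈ p → x ∈ q → p ∖ x ≡ q ∖ x → p ≡ q
∖-cancel x∈p x∈q e = ⊆-antisym (sub x∈q e) (sub x∈p (sym e))
  where
  sub : ∀ {p q x} → x ∈ q → p ∖ x ≡ q ∖ x → p ⊆ q
  sub {p} {q} {x} x∈q e {y} y∈p with y Finₚ.≟ x
  ... | yes refl = x∈q
  ... | no  y≢x  = p─q⊆p q ⁅ x ⁆ (subst (y ∈_) e (x∈p∧x≢y⇒x∈p-y y∈p y≢x))

∖-injective : {p : Subset n} {x y : Fin n} → x ∈ p → p ∖ x ≡ p ∖ y → x ≡ y
∖-injective {p = p} {x} {y} x∈p e with x Finₚ.≟ y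
... | yes x≡y = x≡y
... | no  x≢y = contradiction (subst (x ∈_) (sym e) (x∈p∧x≢y⇒x∈p-y x∈p x≢y)) (x∉p-x p)

-- The two non-memberships force `i ≢ j` and `S ≢ T`, and they make the relation invariant under
-- swapping `i` with `j` and `S` with `T` at once.
record Exchange {n} (i j : Fin n) (S T : Subset n) : Set where
  constructor exchange
  field
    i∈S : i ∈ S
    j∉S : j ∉ S
    j∈T : j ∈ T
    i∉T : i ∉ T
    S∖i≡T∖j : S ∖ i ≡ T ∖ j

exchange? : (i j : Fin n) (S T : Subset n) → Dec (Exchange i j S T)
exchange? i j S T = map′
  (λ (a , b , c , d , e) → exchange a b c d e) (λ (exchange a b c d e) → a , b , c , d , e)
  (i ∈? S ×-dec ¬? (j ∈? S) ×-dec j ∈? T ×-dec ¬? (i ∈? T) ×-dec (S ∖ i) ≟ˢ (T ∖ j))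

exchange-sym : {i j : Fin n} {S T : Subset n} → Exchange i j S T → Exchange j i T S
exchange-sym (exchange a b c d e) = exchange c d a b (sym e)

exchange-determinesʳ : {i j : Fin n} {S T T′ : Subset n} → Exchange i j S T → Exchange i j S T′ → T ≡ T′
exchange-determinesʳ x y = ∖-cancel (Exchange.j∈T x) (Exchange.j∈T y)
  (trans (sym (Exchange.S∖i≡T∖j x)) (Exchange.S∖i≡T∖j y))

-- The vertex `i` is the only element of `S` outside `T`.
exchange-determines-i : {i j i′ j′ : Fin n} {S T : Subset n} → Exchange i j S T → Exchange i′ j′ S T → i ≡ i′
exchange-determines-i {i = i} {j} {i′} {T = T} x y with i Finₚ.≟ i′
... | yes i≡i′ = i≡i′
... | no  i≢i′ = contradiction
  (p─q⊆p T ⁅ j ⁆ (subst (i′ ∈_) (Exchange.S∖i≡T∖j x) (x∈p∧x≢y⇒x∈p-y (Exchange.i∈S y) (i≢i′ ∘ sym))))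
  (Exchange.i∉T y)

exchange-determines-j : {i j i′ j′ : Fin n} {S T : Subset n} → Exchange i j S T → Exchange i′ j′ S T → j ≡ j′
exchange-determines-j x y = exchange-determines-i (exchange-sym x) (exchange-sym y)

-- If `j` lay in `S`, then either `j = i`, and restoring it on both sides gives `S ≡ T`, or `j`
-- survives on the left although it has been removed on the right.
common-facet⇒exchange : {i j : Fin n} {S T : Subset n} → S ≢ T → i ∈ S → j ∈ T → S ∖ i ≡ T ∖ j → Exchange i j S T
common-facet⇒exchange S≢T i∈S j∈T e =
  exchange i∈S (absent S≢T j∈T e) j∈T (absent (S≢T ∘ sym) i∈S (sym e)) e
  where
  absent : ∀ {i j S T} → S ≢ T → j ∈ T → S ∖ i ≡ T ∖ j → j ∉ S
  absent {i} {j} {S} {T} S≢T j∈T e j∈S with j Finₚ.≟ i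
  ... | yes refl = S≢T (∖-cancel j∈S j∈T e)
  ... | no  j≢i  = x∉p-x T (subst (j ∈_) e (x∈p∧x≢y⇒x∈p-y j∈S j≢i))

replace : Subset n → Fin n → Fin n → Subset n
replace S i j = (S ∖ i) ∪ ⁅ j ⁆

∈-replace⁻ : (S : Subset n) {i j x : Fin n} → x ∈ replace S i j → x ≡ j ⊎ (x ∈ S × x ≢ i)
∈-replace⁻ S {i} {j} x∈ with x∈p∪q⁻ (S ∖ i) ⁅ j ⁆ x∈
... | inj₁ x∈S∖i = inj₂ (∈-∖⁻ S x∈S∖i)
... | inj₂ x∈⁅j⁆ = inj₁ (x∈⁅y⁆⇒x≡y j x∈⁅j⁆)

j∈replace : (S : Subset n) {i j : Fin n} → j ∈ replace S i j
j∈replace S {i} {j} = x∈p∪q⁺ {p = S ∖ i} (inj₂ (x∈⁅x⁆ j))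

∈-replace⁺ : {S : Subset n} {i j x : Fin n} → x ∈ S → x ≢ i → x ∈ replace S i j
∈-replace⁺ x∈S x≢i = x∈p∪q⁺ (inj₁ (x∈p∧x≢y⇒x∈p-y x∈S x≢i))

exchange-replace : {S : Subset n} {i j : Fin n} → i ∈ S → j ∉ S → Exchange i j S (replace S i j)
exchange-replace {S = S} {i} {j} i∈S j∉S = exchange i∈S j∉S (j∈replace S) i∉ (⊆-antisym to from)
  where
  i∉ : i ∉ replace S i j
  i∉ i∈ with ∈-replace⁻ S i∈
  ... | inj₁ refl      = j∉S i∈S
  ... | inj₂ (_ , i≢i) = i≢i refl
  to : S ∖ i ⊆ replace S i j ∖ j
  to x∈ with x∈S , x≢i ← ∈-∖⁻ S x∈ = x∈p∧x≢y⇒x∈p-y (∈-replace⁺ x∈S x≢i) λ { refl → j∉S x∈S }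
  from : replace S i j ∖ j ⊆ S ∖ i
  from x∈ with x∈r , x≢j ← ∈-∖⁻ (replace S i j) x∈ with ∈-replace⁻ S x∈r
  ... | inj₁ x≡j         = contradiction x≡j x≢j
  ... | inj₂ (x∈S , x≢i) = x∈p∧x≢y⇒x∈p-y x∈S x≢i

exchange-size : {i j : Fin n} {S T : Subset n} → Exchange i j S T → ∣ S ∣ ≡ ∣ T ∣
exchange-size {S = S} {T} (exchange i∈S _ j∈T _ e) =
  trans (sym (∣p-x∣ S i∈S)) (trans (cong (suc ∘ ∣_∣) e) (∣p-x∣ T j∈T))

-- Exchanges in a uniform set family

module UniformFamily (F : Fin m → Subset n) (c : ℕ) (size : ∀ l → ∣ F l ∣ ≡ c)
                     (F-injective : ∀ {l l′} → F l ≡ F l′ → l ≡ l′) where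

  degree : Fin n → ℕ
  degree v = sum λ l → 𝟙 (v ∈? F l)

  both : Fin n → Fin n → ℕ
  both i j = sum λ l → 𝟙 (i ∈? F l ×-dec j ∈? F l)

  only : Fin n → Fin n → ℕ
  only i j = sum λ l → 𝟙 (i ∈? F l ×-dec ¬? (j ∈? F l))

  exchangesAt : Fin n → Fin n → Fin m → ℕ
  exchangesAt i j l = sum λ l′ → 𝟙 (exchange? i j (F l) (F l′))

  exchanges : Fin n → Fin n → ℕ
  exchanges i j = sum (exchangesAt i j)

  degree-split : ∀ i j → degree i ≡ both i j + only i j
  degree-split i j = trans (sum-cong-≗ λ l → 𝟙-split (i ∈? F l) (j ∈? F l))
    (∑-distrib-+ (λ l → 𝟙 (i ∈? F l ×-dec j ∈? F l)) _)

  both-sym : ∀ i j → both i j ≡ both j i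
  both-sym i j = sum-cong-≗ λ l →
    𝟙-cong (i ∈? F l ×-dec j ∈? F l) (j ∈? F l ×-dec i ∈? F l) swap swap

  exchanges-sym : ∀ i j → exchanges i j ≡ exchanges j i
  exchanges-sym i j = trans
    (∑-comm λ l l′ → 𝟙 (exchange? i j (F l) (F l′)))
    (sum-cong-≗ λ l′ → sum-cong-≗ λ l →
      𝟙-cong (exchange? i j (F l) (F l′)) (exchange? j i (F l′) (F l)) exchange-sym exchange-sym)

  exchangePartner? : ∀ i j l → Dec (∃[ l′ ] Exchange i j (F l) (F l′))
  exchangePartner? i j l = Finₚ.any? λ l′ → exchange? i j (F l) (F l′)

  -- The partner of `F l` is determined as a set, and `F` is injective, so the number of partners is
  -- 0 or 1.
  exchangesAt≡ : ∀ i j l → exchangesAt i j l ≡ 𝟙 (exchangePartner? i j l)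
  exchangesAt≡ i j l = sum-unique (exchangePartner? i j l) (λ l′ → exchange? i j (F l) (F l′))
    (λ x y → F-injective (exchange-determinesʳ x y)) (λ x → x) (λ {l′} x → l′ , x)

  exchangesAt≤ : ∀ i j l → exchangesAt i j l ≤ 𝟙 (i ∈? F l ×-dec ¬? (j ∈? F l))
  exchangesAt≤ i j l = ℕₚ.≤-trans (ℕₚ.≤-reflexive (exchangesAt≡ i j l))
    (𝟙-mono (exchangePartner? i j l) (i ∈? F l ×-dec ¬? (j ∈? F l))
      λ (_ , x) → Exchange.i∈S x , Exchange.j∉S x)

  exchanges≤only : ∀ i j → exchanges i j ≤ only i j
  exchanges≤only i j = sum-mono (exchangesAt≤ i j)

  exchanges≤⊓ : ∀ i j → exchanges i j ≤ only i j ⊓ only j i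
  exchanges≤⊓ i j = ℕₚ.⊓-glb (exchanges≤only i j)
    (ℕₚ.≤-trans (ℕₚ.≤-reflexive (exchanges-sym i j)) (exchanges≤only j i))

  -- Stability of the family under the compression that replaces `i` with `j`.
  Exchangeable : Fin n → Fin n → Set
  Exchangeable i j = ∀ l → i ∈ F l → j ∉ F l → ∃[ l′ ] Exchange i j (F l) (F l′)

  only≤exchanges⇒exchangeable : ∀ {i j} → exchanges i j ≡ only i j → Exchangeable i j
  only≤exchanges⇒exchangeable {i} {j} e l i∈F j∉F with exchangePartner? i j l | exchangesAt≡ i j l
  ... | yes x | _    = x
  ... | no  _ | at≡0 = contradiction
    (trans (sym at≡0) (trans (sum-tight (exchangesAt≤ i j) e l) (𝟙-yes (i ∈? F l ×-dec ¬? (j ∈? F l)) (i∈F , j∉F))))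
    λ ()

  exchangeable⇒exchanges≡only : ∀ {i j} → Exchangeable i j → exchanges i j ≡ only i j
  exchangeable⇒exchanges≡only {i} {j} x = ℕₚ.≤-antisym (exchanges≤only i j) (sum-mono λ l →
    ℕₚ.≤-trans
      (𝟙-mono (i ∈? F l ×-dec ¬? (j ∈? F l)) (exchangePartner? i j l) λ (i∈ , j∉) → x l i∈ j∉)
      (ℕₚ.≤-reflexive (sym (exchangesAt≡ i j l))))

  exchangeable⇒exchanges≡⊓ : ∀ {i j} → Exchangeable i j → exchanges i j ≡ only i j ⊓ only j i
  exchangeable⇒exchanges≡⊓ {i} {j} x = ℕₚ.≤-antisym (exchanges≤⊓ i j)
    (ℕₚ.≤-trans (ℕₚ.m⊓n≤m (only i j) (only j i)) (ℕₚ.≤-reflexive (sym (exchangeable⇒exchanges≡only x))))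

  -- Members containing both vertices contribute equally to both degrees, so `degree i ≤ degree j`
  -- amounts to `only i j ≤ only j i`: the minimum is `only i j`, and every member counted there has
  -- a partner.
  exchanges≡⊓⇒exchangeable : ∀ {i j} → exchanges i j ≡ only i j ⊓ only j i →
    degree i ≤ degree j → Exchangeable i j
  exchanges≡⊓⇒exchangeable {i} {j} e di≤dj =
    only≤exchanges⇒exchangeable (trans e (ℕₚ.m≤n⇒m⊓n≡m only≤))
    where
    only≤ : only i j ≤ only j i
    only≤ = ℕₚ.+-cancelˡ-≤ (both i j) _ _ (ℕₚ.≤-trans
      (ℕₚ.≤-reflexive (sym (degree-split i j)))
      (ℕₚ.≤-trans di≤dj (ℕₚ.≤-reflexive
        (trans (degree-split j i) (cong (_+ only j i) (both-sym j i))))))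

  sumOfMinima : ℕ
  sumOfMinima = sum λ i → sum λ j → degree i ⊓ degree j

  -- The square of an entry of the Gram matrix in combinatorial form. For given `l` and `l′` at most
  -- one pair `(i , j)` contributes, so the double sum is an indicator; on the diagonal it is 0.
  gramSquare : Fin m → Fin m → ℕ
  gramSquare l l′ = 𝟙 (l Finₚ.≟ l′) * (c * c) + sum λ i → sum λ j → 𝟙 (exchange? i j (F l) (F l′))

  sumOfGramSquares : ℕ
  sumOfGramSquares = sum λ l → sum λ l′ → gramSquare l l′

  diagonal : ℕ
  diagonal = sum λ (l : Fin m) → c * c

  ∑both≡diagonal : (sum λ i → sum λ j → both i j) ≡ diagonal
  ∑both≡diagonal = begin
    (sum λ i → sum λ j → sum λ l → 𝟙 (i ∈? F l ×-dec j ∈? F l))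
      ≡⟨ (sum-cong-≗ λ i → ∑-comm λ j l → 𝟙 (i ∈? F l ×-dec j ∈? F l)) ⟩
    (sum λ i → sum λ l → sum λ j → 𝟙 (i ∈? F l ×-dec j ∈? F l))
      ≡⟨ (∑-comm λ i l → sum λ j → 𝟙 (i ∈? F l ×-dec j ∈? F l)) ⟩
    (sum λ l → sum λ i → sum λ j → 𝟙 (i ∈? F l ×-dec j ∈? F l))
      ≡⟨ (sum-cong-≗ λ l → sum-cong-≗ λ i → sum-cong-≗ λ j → 𝟙-× (i ∈? F l) (j ∈? F l)) ⟩
    (sum λ l → sum λ i → sum λ j → 𝟙 (i ∈? F l) * 𝟙 (j ∈? F l))
      ≡⟨ (sum-cong-≗ λ l → sum-*-sum ℕₚ.+-*-commutativeSemiring (λ i → 𝟙 (i ∈? F l)) λ j → 𝟙 (j ∈? F l)) ⟨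
    (sum λ l → (sum λ i → 𝟙 (i ∈? F l)) * (sum λ j → 𝟙 (j ∈? F l)))
      ≡⟨ (sum-cong-≗ λ l → let e = trans (sum-membership (F l)) (size l) in cong₂ _*_ e e) ⟩
    diagonal ∎
    where open ≡-Reasoning

  sumOfMinima≡ : sumOfMinima ≡ diagonal + sum λ i → sum λ j → only i j ⊓ only j i
  sumOfMinima≡ = begin
    (sum λ i → sum λ j → degree i ⊓ degree j)
      ≡⟨ (sum-cong-≗ λ i → sum-cong-≗ λ j → minimum i j) ⟩
    (sum λ i → sum λ j → both i j + only i j ⊓ only j i)
      ≡⟨ (sum-cong-≗ λ i → ∑-distrib-+ (both i) λ j → only i j ⊓ only j i) ⟩
    (sum λ i → (sum λ j → both i j) + (sum λ j → only i j ⊓ only j i))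
      ≡⟨ ∑-distrib-+ (λ i → sum λ j → both i j) (λ i → sum λ j → only i j ⊓ only j i) ⟩
    (sum λ i → sum λ j → both i j) + (sum λ i → sum λ j → only i j ⊓ only j i)
      ≡⟨ cong (_+ sum λ i → sum λ j → only i j ⊓ only j i) ∑both≡diagonal ⟩
    diagonal + (sum λ i → sum λ j → only i j ⊓ only j i) ∎
    where
    open ≡-Reasoning
    minimum : ∀ i j → degree i ⊓ degree j ≡ both i j + only i j ⊓ only j i
    minimum i j = trans
      (cong₂ _⊓_ (degree-split i j) (trans (degree-split j i) (cong (_+ only j i) (both-sym j i))))
      (sym (ℕₚ.+-distribˡ-⊓ (both i j) (only i j) (only j i)))

  sumOfGramSquares≡ : sumOfGramSquares ≡ diagonal + sum λ i → sum λ j → exchanges i j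
  sumOfGramSquares≡ = begin
    (sum λ l → sum λ l′ → gramSquare l l′)
      ≡⟨ (sum-cong-≗ λ l → ∑-distrib-+ (λ l′ → 𝟙 (l Finₚ.≟ l′) * (c * c)) (ex l)) ⟩
    (sum λ l → (sum λ l′ → 𝟙 (l Finₚ.≟ l′) * (c * c)) + sum (ex l))
      ≡⟨ (sum-cong-≗ λ l → cong (_+ sum (ex l)) (diagonalTerm l)) ⟩
    (sum λ l → c * c + sum (ex l))
      ≡⟨ ∑-distrib-+ (λ l → c * c) (λ l → sum (ex l)) ⟩
    diagonal + (sum λ l → sum λ l′ → sum λ i → sum λ j → 𝟙 (exchange? i j (F l) (F l′)))
      ≡⟨ cong (diagonal +_) (∑⁴-comm ℕₚ.+-0-commutativeMonoid λ l l′ i j → 𝟙 (exchange? i j (F l) (F l′))) ⟩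
    diagonal + (sum λ i → sum λ j → exchanges i j) ∎
    where
    open ≡-Reasoning
    ex : Fin m → Fin m → ℕ
    ex l l′ = sum λ i → sum λ j → 𝟙 (exchange? i j (F l) (F l′))
    diagonalTerm : ∀ l → (sum λ l′ → 𝟙 (l Finₚ.≟ l′) * (c * c)) ≡ c * c
    diagonalTerm l = trans
      (sum-single ℕₚ.+-0-commutativeMonoid (λ l′ → 𝟙 (l Finₚ.≟ l′) * (c * c)) l λ l′ l′≢l →
        cong (_* (c * c)) (𝟙-no (l Finₚ.≟ l′) (l′≢l ∘ sym)))
      (trans (cong (_* (c * c)) (𝟙-yes (l Finₚ.≟ l) refl)) (ℕₚ.+-identityʳ _))

  sumOfGramSquares≤sumOfMinima : sumOfGramSquares ≤ sumOfMinima
  sumOfGramSquares≤sumOfMinima = ℕₚ.≤-trans (ℕₚ.≤-reflexive sumOfGramSquares≡)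
    (ℕₚ.≤-trans (ℕₚ.+-monoʳ-≤ diagonal (sum-mono λ i → sum-mono λ j → exchanges≤⊓ i j))
      (ℕₚ.≤-reflexive (sym sumOfMinima≡)))

  tight⇒exchangeable : sumOfGramSquares ≡ sumOfMinima → ∀ i j → degree i ≤ degree j → Exchangeable i j
  tight⇒exchangeable e i j = exchanges≡⊓⇒exchangeable
    (sum-tight (λ j → exchanges≤⊓ i j)
      (sum-tight (λ i → sum-mono λ j → exchanges≤⊓ i j)
        (ℕₚ.+-cancelˡ-≡ diagonal _ _ (trans (sym sumOfGramSquares≡) (trans e sumOfMinima≡))) i) j)

  -- Both `exchanges i j` and the minimum are symmetric in `i` and `j`, so one direction for each
  -- pair suffices.
  exchangeable⇒tight : (∀ i j → Exchangeable i j ⊎ Exchangeable j i) → sumOfGramSquares ≡ sumOfMinima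
  exchangeable⇒tight x = trans sumOfGramSquares≡ (trans
    (cong (diagonal +_) (sum-cong-≗ λ i → sum-cong-≗ λ j → tight i j (x i j)))
    (sym sumOfMinima≡))
    where
    tight : ∀ i j → Exchangeable i j ⊎ Exchangeable j i → exchanges i j ≡ only i j ⊓ only j i
    tight i j (inj₁ y) = exchangeable⇒exchanges≡⊓ y
    tight i j (inj₂ y) = trans (exchanges-sym i j)
      (trans (exchangeable⇒exchanges≡⊓ y) (ℕₚ.⊓-comm (only j i) (only i j)))

-- The list of faces of a given size

Unique-lookup-injective : {A : Set a} {xs : List A} → Unique xs →
  ∀ {i j} → lookup xs i ≡ lookup xs j → i ≡ j
Unique-lookup-injective {xs = x ∷ xs} (x≢ ∷ u) {zero}  {zero}  e = refl
Unique-lookup-injective {xs = x ∷ xs} (x≢ ∷ u) {zero}  {suc j} e = contradiction e (All.lookup x≢ (∈-lookup j))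
Unique-lookup-injective {xs = x ∷ xs} (x≢ ∷ u) {suc i} {zero}  e = contradiction (sym e) (All.lookup x≢ (∈-lookup i))
Unique-lookup-injective {xs = x ∷ xs} (x≢ ∷ u) {suc i} {suc j} e = cong suc (Unique-lookup-injective u e)

allSubsets-complete : (S : Subset n) → S ∈ˡ allSubsets n
allSubsets-complete []            = Any.here refl
allSubsets-complete (inside  ∷ S) = ∈-++⁺ˡ (∈-map⁺ (inside ∷_) (allSubsets-complete S))
allSubsets-complete {suc n} (outside ∷ S) =
  ∈-++⁺ʳ (map (inside ∷_) (allSubsets n)) (∈-map⁺ (outside ∷_) (allSubsets-complete S))

allSubsets-unique : ∀ n → Unique (allSubsets n)
allSubsets-unique zero    = [] ∷ []
allSubsets-unique (suc n) = Uniqueₚ.++⁺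
  (Uniqueₚ.map⁺ Vecₚ.∷-injectiveʳ (allSubsets-unique n))
  (Uniqueₚ.map⁺ Vecₚ.∷-injectiveʳ (allSubsets-unique n))
  λ (x∈ , y∈) → heads-differ (∈-map⁻ (inside ∷_) x∈) (∈-map⁻ (outside ∷_) y∈)
  where
  heads-differ : {x : Subset (suc n)} → ∃[ y ] (y ∈ˡ allSubsets n × x ≡ inside ∷ y) →
    ∃[ z ] (z ∈ˡ allSubsets n × x ≡ outside ∷ z) → ⊥
  heads-differ (_ , _ , refl) (_ , _ , ())

module FacesOfSize (K : SimplicialComplex n) (c : ℕ) where

  face : Fin (numFacesOfSize K c) → Subset n
  face = lookup (facesOfSize K c)

  private
    isFace? : Decidable λ S → Face K S × ∣ S ∣ ≡ c
    isFace? S = Face? K S ×-dec (∣ S ∣ ℕₚ.≟ c)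

  sound : ∀ l → Face K (face l) × ∣ face l ∣ ≡ c
  sound l = proj₂ (∈-filter⁻ isFace? {xs = allSubsets n} (∈-lookup {xs = facesOfSize K c} l))

  complete : ∀ {S} → Face K S → ∣ S ∣ ≡ c → ∃[ l ] face l ≡ S
  complete {S} S∈K size = let S∈ = ∈-filter⁺ isFace? (allSubsets-complete S) (S∈K , size) in
    index S∈ , sym (lookup-index S∈)

  injective : ∀ {l l′} → face l ≡ face l′ → l ≡ l′
  injective = Unique-lookup-injective (Uniqueₚ.filter⁺ isFace? (allSubsets-unique n))

  open UniformFamily face c (proj₂ ∘ sound) injective public

-- The transposed degree sequence as a sum of minima

module Facets (K : SimplicialComplex n) (k : ℕ) where

  open FacesOfSize K (suc k) public

  deg≡degree : ∀ v → deg K k v ≡ degree v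
  deg≡degree v = count-lookup (v ∈?_) (facesOfSize K (suc k))

  degᵀ-squares≡sumOfMinima : degᵀ-squares K k ≡ sumOfMinima
  degᵀ-squares≡sumOfMinima = begin
    degᵀ-squares K k
      ≡⟨ sum-applyUpTo (λ r → degᵀ K k (suc r) ℕ.^ 2) (λ r → r) M ⟩
    (sum λ (r : Fin M) → degᵀ K k (suc (toℕ r)) ℕ.^ 2)
      ≡⟨ (sum-cong-≗ {M} λ r → square (suc (toℕ r))) ⟩
    (sum λ (r : Fin M) → sum λ i → sum λ j → atLeast (suc (toℕ r)) i * atLeast (suc (toℕ r)) j)
      ≡⟨ (∑-comm λ (r : Fin M) i → sum λ j → atLeast (suc (toℕ r)) i * atLeast (suc (toℕ r)) j) ⟩
    (sum λ i → sum λ (r : Fin M) → sum λ j → atLeast (suc (toℕ r)) i * atLeast (suc (toℕ r)) j)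
      ≡⟨ (sum-cong-≗ λ i → ∑-comm λ (r : Fin M) j → atLeast (suc (toℕ r)) i * atLeast (suc (toℕ r)) j) ⟩
    (sum λ i → sum λ j → sum λ (r : Fin M) → atLeast (suc (toℕ r)) i * atLeast (suc (toℕ r)) j)
      ≡⟨ (sum-cong-≗ λ i → sum-cong-≗ λ j → thresholds i j) ⟩
    (sum λ i → sum λ j → deg K k i ⊓ deg K k j)
      ≡⟨ (sum-cong-≗ λ i → sum-cong-≗ λ j → cong₂ _⊓_ (deg≡degree i) (deg≡degree j)) ⟩
    sumOfMinima ∎
    where
    open ≡-Reasoning
    M : ℕ
    M = numFacesOfSize K (suc k)
    atLeast : ℕ → Fin n → ℕ
    atLeast r v = 𝟙 (r ℕₚ.≤? deg K k v)
    square : ∀ r → degᵀ K k r ℕ.^ 2 ≡ sum λ i → sum λ j → atLeast r i * atLeast r j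
    square r = trans (cong (degᵀ K k r *_) (ℕₚ.*-identityʳ _))
      (trans (cong (λ x → x * x) (count-tabulate (λ v → r ℕₚ.≤? deg K k v) λ v → v))
        (sum-*-sum ℕₚ.+-*-commutativeSemiring (atLeast r) (atLeast r)))
    thresholds : ∀ i j → (sum λ (r : Fin M) → atLeast (suc (toℕ r)) i * atLeast (suc (toℕ r)) j) ≡
                         deg K k i ⊓ deg K k j
    thresholds i j = trans
      (sum-cong-≗ {M} λ r → let t = suc (toℕ r); t≤i = t ℕₚ.≤? deg K k i; t≤j = t ℕₚ.≤? deg K k j in trans
        (sym (𝟙-× t≤i t≤j))
        (𝟙-cong (t≤i ×-dec t≤j) (t ℕₚ.≤? deg K k i ⊓ deg K k j)
          (λ (p , q) → ℕₚ.⊓-glb p q)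
          λ p → ℕₚ.≤-trans p (ℕₚ.m⊓n≤m _ _) , ℕₚ.≤-trans p (ℕₚ.m⊓n≤n (deg K k i) _)))
      -- The truncation at `M` is harmless because a degree is the length of a filtered list of the
      -- `M` facets.
      (sum-thresholds M (ℕₚ.≤-trans (ℕₚ.m⊓n≤m _ _) (length-filter (i ∈?_) (facesOfSize K (suc k)))))

-- The Gram matrix BᵀB of the columns of the boundary matrix

module ℤ∑ = SemiringSum (CommutativeSemiring.semiring ℤₚ.+-*-commutativeSemiring)

pos-sum : (f : Fin m → ℕ) → ℤ.+ sum f ≡ ℤ∑.sum λ i → ℤ.+ f i
pos-sum {zero}  f = refl
pos-sum {suc m} f = cong (ℤ._+_ (ℤ.+ f zero)) (pos-sum (f ∘ suc))

∣i∣²≡i² : ∀ i → ℤ.+ (ℤ.∣ i ∣ * ℤ.∣ i ∣) ≡ i ℤ.* i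
∣i∣²≡i² (ℤ.+ m)    = ℤₚ.pos-* m m
∣i∣²≡i² ℤ.-[1+ m ] = refl

*-square : ∀ i j → (i ℤ.* j) ℤ.* (i ℤ.* j) ≡ (i ℤ.* i) ℤ.* (j ℤ.* j)
*-square i j = interchange i j i j
  where open CommutativeSemigroupProperties ℤₚ.*-commutativeSemigroup using (interchange)

sign² : ∀ m → (-1ℤ ℤ.^ m) ℤ.* (-1ℤ ℤ.^ m) ≡ 1ℤ
sign² zero    = refl
sign² (suc m) = trans (*-square -1ℤ (-1ℤ ℤ.^ m)) (cong (1ℤ ℤ.*_) (sign² m))

module Boundary (K : SimplicialComplex n) (ω : Orientation K) (k : ℕ) where

  open Facets K k
  module Ridges = FacesOfSize K k

  -- The condition for a nonzero incidence, stated with a vertex instead of an index into the chosen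
  -- ordering. Membership of `v` matters: removing a vertex outside `F` would return `F` itself.
  Covered : Subset n → Subset n → Set
  Covered S F = ∃[ v ] (v ∈ F × S ≡ F ∖ v)

  covered? : ∀ S F → Dec (Covered S F)
  covered? S F = Finₚ.any? λ v → v ∈? F ×-dec (S ≟ˢ (F ∖ v))

  -- Whichever index the search finds, both factors of the incidence are powers of -1.
  incidence² : ∀ {S F} → Face K F → Covered S F → incidence ω S F ℤ.* incidence ω S F ≡ 1ℤ
  incidence² {S} {F} F∈K (v , v∈F , S≡F∖v) with Finₚ.any? (λ i → S ≟ˢ (F ∖ lookup (order ω F) i))
  ... | yes (i , _) = trans (*-square (-1ℤ ℤ.^ toℕ i) _) (cong₂ ℤ._*_ (sign² (toℕ i))
    (sign² (inversions (map (position (List.removeAt (order ω F) i)) (order ω S)))))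
  ... | no  none    = contradiction
    (index v∈order , trans S≡F∖v (cong (F ∖_) (lookup-index v∈order))) none
    where
    v∈order : v ∈ˡ order ω F
    v∈order = Equivalence.from (vertex ω F∈K v) v∈F

  incidence-0 : ∀ {S F} → Face K F → ¬ Covered S F → incidence ω S F ≡ 0ℤ
  incidence-0 {S} {F} F∈K ¬cov with Finₚ.any? (λ i → S ≟ˢ (F ∖ lookup (order ω F) i))
  ... | yes (i , e) = contradiction
    (lookup (order ω F) i , Equivalence.to (vertex ω F∈K _) (∈-lookup i) , e) ¬cov
  ... | no  _       = refl

  B : Matrix ℤ (numFacesOfSize K k) (numFacesOfSize K (suc k))
  B = boundary K ω k

  face∈K : ∀ l → Face K (face l)
  face∈K l = proj₁ (sound l)

  gram : Fin (numFacesOfSize K (suc k)) → Fin (numFacesOfSize K (suc k)) → ℤ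
  gram l l′ = ℤ∑.sum λ i → B i l ℤ.* B i l′

  ridge : ∀ l v → v ∈ face l → ∃[ i ] Ridges.face i ≡ face l ∖ v
  ridge l v v∈ = Ridges.complete
    (down-closed K (p─q⊆p (face l) ⁅ v ⁆) (face∈K l))
    (ℕₚ.suc-injective (trans (∣p-x∣ (face l) v∈) (proj₂ (sound l))))

  B²≡𝟙 : ∀ i l → B i l ℤ.* B i l ≡ ℤ.+ 𝟙 (covered? (Ridges.face i) (face l))
  B²≡𝟙 i l with covered? (Ridges.face i) (face l)
  ... | yes cov = incidence² (face∈K l) cov
  ... | no ¬cov = cong (λ x → x ℤ.* x) (incidence-0 (face∈K l) ¬cov)

  -- The ridges of a facet correspond to its vertices; the pairs of a ridge and the vertex it omits
  -- are counted in both ways.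
  gram-diagonal : ∀ l → gram l l ≡ ℤ.+ suc k
  gram-diagonal l = begin
    (ℤ∑.sum λ i → B i l ℤ.* B i l)
      ≡⟨ (ℤ∑.sum-cong-≗ λ i → B²≡𝟙 i l) ⟩
    (ℤ∑.sum λ i → ℤ.+ 𝟙 (covered? (Ridges.face i) (face l)))
      ≡⟨ (pos-sum λ i → 𝟙 (covered? (Ridges.face i) (face l))) ⟨
    ℤ.+ (sum λ i → 𝟙 (covered? (Ridges.face i) (face l)))
      ≡⟨ cong ℤ.+_ (sum-cong-≗ λ i → sum-unique (covered? (Ridges.face i) (face l)) (covers? i)
           (λ (v∈ , e) (_ , e′) → ∖-injective v∈ (trans (sym e) e′)) (λ x → x) (λ {v} x → v , x)) ⟨
    ℤ.+ (sum λ i → sum λ v → 𝟙 (covers? i v))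
      ≡⟨ cong ℤ.+_ (∑-comm λ i v → 𝟙 (covers? i v)) ⟩
    ℤ.+ (sum λ v → sum λ i → 𝟙 (covers? i v))
      ≡⟨ cong ℤ.+_ (sum-cong-≗ λ v → sum-unique (v ∈? face l) (λ i → covers? i v)
           (λ (_ , e) (_ , e′) → Ridges.injective (trans e (sym e′)))
           (λ v∈ → let (i , e) = ridge l v v∈ in i , v∈ , e) proj₁) ⟩
    ℤ.+ (sum λ v → 𝟙 (v ∈? face l))
      ≡⟨ cong ℤ.+_ (trans (sum-membership (face l)) (proj₂ (sound l))) ⟩
    ℤ.+ suc k ∎
    where
    open ≡-Reasoning
    covers? : ∀ i v → Dec (v ∈ face l × Ridges.face i ≡ face l ∖ v)
    covers? i v = v ∈? face l ×-dec (Ridges.face i ≟ˢ (face l ∖ v))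

  B*B≡0 : ∀ {i l l′} → ¬ (Covered (Ridges.face i) (face l) × Covered (Ridges.face i) (face l′)) →
          B i l ℤ.* B i l′ ≡ 0ℤ
  B*B≡0 {i} {l} {l′} ¬both with covered? (Ridges.face i) (face l)
  ... | no ¬cov = cong (ℤ._* B i l′) (incidence-0 (face∈K l) ¬cov)
  ... | yes cov = trans (cong (B i l ℤ.*_) (incidence-0 (face∈K l′) λ cov′ → ¬both (cov , cov′)))
                        (ℤₚ.*-zeroʳ (B i l))

  -- A common ridge of distinct facets omits the unique vertex of the first that is missing from the
  -- second. Hence the sum has one nonzero term, a product of two signs.
  gram-adjacent : ∀ {v w l l′} → Exchange v w (face l) (face l′) → gram l l′ ℤ.* gram l l′ ≡ 1ℤ
  gram-adjacent {v} {w} {l} {l′} x with i , e ← ridge l v (Exchange.i∈S x) = begin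
    gram l l′ ℤ.* gram l l′
      ≡⟨ cong (λ y → y ℤ.* y) (sum-single ℤₚ.+-0-commutativeMonoid (λ j → B j l ℤ.* B j l′) i others) ⟩
    (B i l ℤ.* B i l′) ℤ.* (B i l ℤ.* B i l′)
      ≡⟨ *-square (B i l) (B i l′) ⟩
    (B i l ℤ.* B i l) ℤ.* (B i l′ ℤ.* B i l′)
      ≡⟨ cong₂ ℤ._*_ (incidence² (face∈K l) (v , Exchange.i∈S x , e))
           (incidence² (face∈K l′) (w , Exchange.j∈T x , trans e (Exchange.S∖i≡T∖j x))) ⟩
    1ℤ ∎
    where
    open ≡-Reasoning
    distinct : face l ≢ face l′
    distinct eq = Exchange.i∉T x (subst (v ∈_) eq (Exchange.i∈S x))
    others : ∀ j → j ≢ i → B j l ℤ.* B j l′ ≡ 0ℤ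
    others j j≢i = B*B≡0 λ { ((v′ , v′∈ , e₁) , (w′ , w′∈ , e₂)) →
      j≢i (Ridges.injective (trans e₁ (trans
        (cong (face l ∖_) (exchange-determines-i
          (common-facet⇒exchange distinct v′∈ w′∈ (trans (sym e₁) e₂)) x)) (sym e)))) }

  gram²≡gramSquare : ∀ l l′ → gram l l′ ℤ.* gram l l′ ≡ ℤ.+ gramSquare l l′
  gram²≡gramSquare l l′ with l Finₚ.≟ l′
  ... | yes refl = trans (cong (λ x → x ℤ.* x) (gram-diagonal l)) (trans (sym (ℤₚ.pos-* (suc k) (suc k)))
    (cong ℤ.+_ (sym (trans (cong₂ _+_ (ℕₚ.+-identityʳ (suc k * suc k)) irreflexive) (ℕₚ.+-identityʳ _)))))
    where
    irreflexive : (sum λ i → sum λ j → 𝟙 (exchange? i j (face l) (face l))) ≡ 0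
    irreflexive = sum-zeros ℕₚ.+-0-commutativeMonoid λ i → sum-zeros ℕₚ.+-0-commutativeMonoid λ j →
      𝟙-no (exchange? i j (face l) (face l)) λ x → Exchange.i∉T x (Exchange.i∈S x)
  ... | no  l≢l′ = offDiagonal (Finₚ.any? λ v → Finₚ.any? λ w → exchange? v w (face l) (face l′))
    where
    indicator : Fin n → Fin n → ℕ
    indicator i j = 𝟙 (exchange? i j (face l) (face l′))
    offDiagonal : Dec (∃[ v ] ∃[ w ] Exchange v w (face l) (face l′)) →
      gram l l′ ℤ.* gram l l′ ≡ ℤ.+ (sum λ i → sum λ j → indicator i j)
    offDiagonal (yes (v , w , x)) = trans (gram-adjacent x) (cong ℤ.+_ (sym (begin
      (sum λ i → sum λ j → indicator i j)
        ≡⟨ sum-single ℕₚ.+-0-commutativeMonoid (λ i → sum λ j → indicator i j) v (λ i i≢v →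
             sum-zeros ℕₚ.+-0-commutativeMonoid λ j →
               𝟙-no (exchange? i j (face l) (face l′)) λ y → i≢v (exchange-determines-i y x)) ⟩
      (sum λ j → indicator v j)
        ≡⟨ sum-single ℕₚ.+-0-commutativeMonoid (indicator v) w (λ j j≢w →
             𝟙-no (exchange? v j (face l) (face l′)) λ y → j≢w (exchange-determines-j y x)) ⟩
      indicator v w
        ≡⟨ 𝟙-yes (exchange? v w (face l) (face l′)) x ⟩
      1 ∎)))
      where open ≡-Reasoning
    offDiagonal (no ¬x) = trans
      (cong (λ y → y ℤ.* y) (sum-zeros ℤₚ.+-0-commutativeMonoid {f = λ i → B i l ℤ.* B i l′} λ i →
        B*B≡0 λ { ((v , v∈ , e₁) , (w , w∈ , e₂)) →
          ¬x (v , w , common-facet⇒exchange (l≢l′ ∘ injective) v∈ w∈ (trans (sym e₁) e₂)) }))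
      (cong ℤ.+_ (sym (sum-zeros ℕₚ.+-0-commutativeMonoid λ i → sum-zeros ℕₚ.+-0-commutativeMonoid λ j →
        𝟙-no (exchange? i j (face l) (face l′)) λ x → ¬x (i , j , x))))

  L : Matrix ℤ (numFacesOfSize K k) (numFacesOfSize K k)
  L = upLaplacian K ω k

  upLaplacian-symmetric : ∀ i j → L i j ≡ L j i
  upLaplacian-symmetric i j = ℤ∑.sum-cong-≗ λ l → ℤₚ.*-comm (B i l) (B j l)

  upLaplacian-sumOfSquares : (sum λ i → sum λ j → ℤ.∣ L i j ∣ * ℤ.∣ L i j ∣) ≡ sumOfGramSquares
  upLaplacian-sumOfSquares = ℤₚ.+-injective (begin
    ℤ.+ (sum λ i → sum λ j → ℤ.∣ L i j ∣ * ℤ.∣ L i j ∣)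
      ≡⟨ pos-sum₂ (λ i j → ℤ.∣ L i j ∣ * ℤ.∣ L i j ∣) ⟩
    (ℤ∑.sum λ i → ℤ∑.sum λ j → ℤ.+ (ℤ.∣ L i j ∣ * ℤ.∣ L i j ∣))
      ≡⟨ (ℤ∑.sum-cong-≗ λ i → ℤ∑.sum-cong-≗ λ j → ∣i∣²≡i² (L i j)) ⟩
    (ℤ∑.sum λ i → ℤ∑.sum λ j → L i j ℤ.* L i j)
      ≡⟨ gram-trace² ℤₚ.+-*-commutativeSemiring B ⟩
    (ℤ∑.sum λ l → ℤ∑.sum λ l′ → gram l l′ ℤ.* gram l l′)
      ≡⟨ (ℤ∑.sum-cong-≗ λ l → ℤ∑.sum-cong-≗ λ l′ → gram²≡gramSquare l l′) ⟩
    (ℤ∑.sum λ l → ℤ∑.sum λ l′ → ℤ.+ gramSquare l l′)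
      ≡⟨ pos-sum₂ gramSquare ⟨
    ℤ.+ sumOfGramSquares ∎)
    where
    open ≡-Reasoning
    pos-sum₂ : ∀ {p q} (f : Fin p → Fin q → ℕ) →
      ℤ.+ (sum λ i → sum λ j → f i j) ≡ ℤ∑.sum λ i → ℤ∑.sum λ j → ℤ.+ f i j
    pos-sum₂ f = trans (pos-sum λ i → sum (f i)) (ℤ∑.sum-cong-≗ λ i → pos-sum (f i))

-- Relabelling

∈-preimage⁺ : (π : Permutation′ n) {F : Subset n} {v : Fin n} → π ⟨$⟩ʳ v ∈ F → v ∈ preimage π F
∈-preimage⁺ π {F} {v} πv∈F = Vecₚ.lookup⇒[]= v _
  (trans (Vecₚ.lookup∘tabulate _ v) (Vecₚ.[]=⇒lookup πv∈F))

∈-preimage⁻ : (π : Permutation′ n) {F : Subset n} {v : Fin n} → v ∈ preimage π F → π ⟨$⟩ʳ v ∈ F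
∈-preimage⁻ π {F} {v} v∈ = Vecₚ.lookup⇒[]= (π ⟨$⟩ʳ v) F
  (trans (sym (Vecₚ.lookup∘tabulate _ v)) (Vecₚ.[]=⇒lookup v∈))

image : Permutation′ n → Subset n → Subset n
image π = preimage (flip π)

∈-image⁺ : (π : Permutation′ n) {S : Subset n} {v : Fin n} → v ∈ S → π ⟨$⟩ʳ v ∈ image π S
∈-image⁺ π {S} v∈S = ∈-preimage⁺ (flip π) (subst (_∈ S) (sym (inverseˡ π)) v∈S)

∈-image⁻ : (π : Permutation′ n) {S : Subset n} {v : Fin n} → π ⟨$⟩ʳ v ∈ image π S → v ∈ S
∈-image⁻ π {S} πv∈ = subst (_∈ S) (inverseˡ π) (∈-preimage⁻ (flip π) πv∈)

preimage-image : (π : Permutation′ n) (S : Subset n) → preimage π (image π S) ≡ S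
preimage-image π S = ⊆-antisym (∈-image⁻ π ∘ ∈-preimage⁻ π) (∈-preimage⁺ π ∘ ∈-image⁺ π)

preimage-injective : (π : Permutation′ n) {F G : Subset n} → preimage π F ≡ preimage π G → F ≡ G
preimage-injective π {F} {G} e = trans (sym (preimage-image (flip π) F))
  (trans (cong (preimage (flip π)) e) (preimage-image (flip π) G))

∣preimage∣ : (π : Permutation′ n) (F : Subset n) → ∣ preimage π F ∣ ≡ ∣ F ∣
∣preimage∣ π F = begin
  ∣ preimage π F ∣                       ≡⟨ sum-membership (preimage π F) ⟨
  (sum λ v → 𝟙 (v ∈? preimage π F))      ≡⟨ (sum-cong-≗ λ v → 𝟙-cong (v ∈? preimage π F) (π ⟨$⟩ʳ v ∈? F) (∈-preimage⁻ π) (∈-preimage⁺ π)) ⟩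
  (sum λ v → 𝟙 (π ⟨$⟩ʳ v ∈? F))          ≡⟨ sum-permute (λ w → 𝟙 (w ∈? F)) π ⟨
  (sum λ w → 𝟙 (w ∈? F))                 ≡⟨ sum-membership F ⟩
  ∣ F ∣                                  ∎
  where open ≡-Reasoning

-- The two lists of facets are enumerated independently and may be ordered differently, so the
-- facets are matched by double counting the pairs that correspond under `π`.
deg-relabel : (K : SimplicialComplex n) (k : ℕ) (π : Permutation′ n) (v : Fin n) →
  deg (relabel π K) k (π ⟨$⟩ʳ v) ≡ deg K k v
deg-relabel K k π v = begin
  deg (relabel π K) k (π ⟨$⟩ʳ v)
    ≡⟨ K′.deg≡degree (π ⟨$⟩ʳ v) ⟩
  (sum λ l′ → 𝟙 (π ⟨$⟩ʳ v ∈? K′.face l′))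
    ≡⟨ (sum-cong-≗ λ l′ → sum-unique (π ⟨$⟩ʳ v ∈? K′.face l′) (λ l → corresponds? l l′)
         (λ (_ , e) (_ , e′) → K.injective (trans e (sym e′)))
         (λ πv∈ → let (l , e) = pulled l′ in l , subst (v ∈_) (sym e) (∈-preimage⁺ π πv∈) , e)
         (λ (v∈ , e) → ∈-preimage⁻ π (subst (v ∈_) e v∈))) ⟨
  (sum λ l′ → sum λ l → 𝟙 (corresponds? l l′))
    ≡⟨ (∑-comm λ l′ l → 𝟙 (corresponds? l l′)) ⟩
  (sum λ l → sum λ l′ → 𝟙 (corresponds? l l′))
    ≡⟨ (sum-cong-≗ λ l → sum-unique (v ∈? K.face l) (corresponds? l)
         (λ (_ , e) (_ , e′) → K′.injective (preimage-injective π (trans (sym e) e′)))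
         (λ v∈ → let (l′ , e) = pushed l in l′ , v∈ , trans (sym (preimage-image π (K.face l))) (cong (preimage π) (sym e)))
         proj₁) ⟩
  (sum λ l → 𝟙 (v ∈? K.face l))
    ≡⟨ K.deg≡degree v ⟨
  deg K k v ∎
  where
  open ≡-Reasoning
  module K = Facets K k
  module K′ = Facets (relabel π K) k
  corresponds? : ∀ l l′ → Dec (v ∈ K.face l × K.face l ≡ preimage π (K′.face l′))
  corresponds? l l′ = v ∈? K.face l ×-dec (K.face l ≟ˢ preimage π (K′.face l′))
  pulled : ∀ l′ → ∃[ l ] K.face l ≡ preimage π (K′.face l′)
  pulled l′ = K.complete (proj₁ (K′.sound l′))
    (trans (∣preimage∣ π (K′.face l′)) (proj₂ (K′.sound l′)))
  pushed : ∀ l → ∃[ l′ ] K′.face l′ ≡ image π (K.face l)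
  pushed l = K′.complete
    (subst (Face K) (sym (preimage-image π (K.face l))) (proj₁ (K.sound l)))
    (trans (∣preimage∣ (flip π) (K.face l)) (proj₂ (K.sound l)))

-- Shifted complexes

elements-sorted : (F : Subset n) → AllPairs Fin._<_ (elements F)
elements-sorted F = AllPairsₚ.filter⁺ (_∈? F) (AllPairsₚ.tabulate⁺-< λ i<j → i<j)

∈-elements⁺ : {F : Subset n} {v : Fin n} → v ∈ F → v ∈ˡ elements F
∈-elements⁺ {F = F} {v} v∈F = ∈-filter⁺ (_∈? F) (∈-allFin v) v∈F

elements⊆ : (F : Subset n) → All (_∈ F) (elements F)
elements⊆ {n} F = All.tabulate λ v∈ → proj₂ (∈-filter⁻ (_∈? F) {xs = allFin n} v∈)

-- `lower` also covers `i ∈ G`, where the replacement merely drops `j`. The induction tracks only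
-- which elements are present, and ends with an `H` that contains `fs`.
module _ (Q : Subset n → Set)
         (lower : ∀ {G i j} → i Fin.< j → j ∈ G → Q G → Q (replace G j i)) where

  -- The elements of G are lowered to those of F one at a time, smallest first; vs are the
  -- elements already treated.
  lower-elements : ∀ vs fs gs {G} → AllPairs Fin._<_ fs → AllPairs Fin._<_ gs →
    Pointwise Fin._≤_ fs gs → All (λ v → All (v Fin.<_) fs) vs →
    Q G → All (_∈ G) vs → All (_∈ G) gs →
    ∃[ H ] Q H × All (_∈ H) vs × All (_∈ H) fs
  lower-elements vs [] [] _ _ [] _ QG vs⊆G _ = _ , QG , vs⊆G , []
  lower-elements vs (f ∷ fs) (g ∷ gs) {G} (f< ∷ fs<) (g< ∷ gs<) (f≤g ∷ fs≤gs) vs< QG vs⊆G (g∈G ∷ gs⊆G)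
    with f Finₚ.≟ g
  ... | yes refl with H , QH , f∈H ∷ vs⊆H , fs⊆H ←
    lower-elements (f ∷ vs) fs gs fs< gs< fs≤gs (f< ∷ All.map All.tail vs<) QG (g∈G ∷ vs⊆G) gs⊆G
    = H , QH , vs⊆H , f∈H ∷ fs⊆H
  ... | no  f≢g  with H , QH , f∈H ∷ vs⊆H , fs⊆H ←
    lower-elements (f ∷ vs) fs gs fs< gs< fs≤gs (f< ∷ All.map All.tail vs<)
      (lower (Finₚ.≤∧≢⇒< f≤g f≢g) g∈G QG)
      -- Trading `g` for `f` loses no treated element, since these lie below `f ≤ g`, and none of
      -- the remaining `gs`, since these lie above `g`.
      (j∈replace G ∷ All.zipWith
        (λ (v∈G , v<) → ∈-replace⁺ v∈G (Finₚ.<⇒≢ (ℕₚ.<-≤-trans (All.head v<) f≤g)))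
        (vs⊆G , vs<))
      (All.zipWith (λ (v∈G , g<v) → ∈-replace⁺ v∈G (Finₚ.<⇒≢ g<v ∘ sym)) (gs⊆G , g<))
    = H , QH , vs⊆H , f∈H ∷ fs⊆H

module _ {G T : Subset n} where

  private
    SameAt : Fin n → Set
    SameAt x = (x ∈ G → x ∈ T) × (x ∈ T → x ∈ G)

  filter-same : ∀ xs → All SameAt xs → Pointwise Fin._≤_ (filter (_∈? T) xs) (filter (_∈? G) xs)
  filter-same []       []       = []
  filter-same (x ∷ xs) ((to , from) ∷ same) with x ∈? G
  ... | yes x∈G rewrite filter-accept (_∈? T) {xs = xs} (to x∈G)  = ℕₚ.≤-refl ∷ filter-same xs same
  ... | no  x∉G rewrite filter-reject (_∈? T) {xs = xs} (x∉G ∘ from) = filter-same xs same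

  module _ {j : Fin n} (j∈G : j ∈ G) (j∉T : j ∉ T) where

    -- Between the inserted and the removed element the list of `T` runs one ahead, and `a` is its
    -- element still waiting for a partner. Each common element `x` is matched with `a` and then
    -- waits in turn; meeting `j`, which only `G` has, closes the gap.
    filter-removed : ∀ a xs → AllPairs Fin._<_ xs → All (a Fin.≤_) xs → j ∈ˡ xs →
      All (λ x → x ≢ j → SameAt x) xs →
      Pointwise Fin._≤_ (a ∷ filter (_∈? T) xs) (filter (_∈? G) xs)
    filter-removed a (x ∷ xs) (x< ∷ xs<) (a≤x ∷ a≤) j∈xs (same ∷ sames) with x Finₚ.≟ j
    ... | yes refl
      rewrite filter-accept (_∈? G) {xs = xs} j∈G | filter-reject (_∈? T) {xs = xs} j∉T
      = a≤x ∷ filter-same xs (All.zipWith (λ (s , x<y) → s (Finₚ.<⇒≢ x<y ∘ sym)) (sames , x<))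
    ... | no  x≢j with x ∈? G
    ...   | yes x∈G rewrite filter-accept (_∈? T) {xs = xs} (proj₁ (same x≢j) x∈G)
      = a≤x ∷ filter-removed x xs xs< (All.map ℕₚ.<⇒≤ x<) (Any.tail (x≢j ∘ sym) j∈xs) sames
    ...   | no  x∉G rewrite filter-reject (_∈? T) {xs = xs} (x∉G ∘ proj₂ (same x≢j))
      = filter-removed a xs xs< a≤ (Any.tail (x≢j ∘ sym) j∈xs) sames

    filter-lowered : ∀ {i} → i ∈ T → i ∉ G → i Fin.< j → ∀ xs → AllPairs Fin._<_ xs →
      i ∈ˡ xs → j ∈ˡ xs → All (λ x → x ≢ i → x ≢ j → SameAt x) xs →
      Pointwise Fin._≤_ (filter (_∈? T) xs) (filter (_∈? G) xs)
    filter-lowered {i} i∈T i∉G i<j (x ∷ xs) (x< ∷ xs<) i∈xs j∈xs (same ∷ sames) with x Finₚ.≟ i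
    ... | yes refl
      rewrite filter-accept (_∈? T) {xs = xs} i∈T | filter-reject (_∈? G) {xs = xs} i∉G
      = filter-removed i xs xs< (All.map ℕₚ.<⇒≤ x<) (Any.tail (Finₚ.<⇒≢ i<j ∘ sym) j∈xs)
          (All.zipWith (λ (s , x<y) → s (Finₚ.<⇒≢ x<y ∘ sym)) (sames , x<))
    ... | no  x≢i with i∈ ← Any.tail (x≢i ∘ sym) i∈xs
      with x≢j ← Finₚ.<⇒≢ (Finₚ.<-trans (All.lookup x< i∈) i<j) with x ∈? G
    ...   | yes x∈G rewrite filter-accept (_∈? T) {xs = xs} (proj₁ (same x≢i x≢j) x∈G)
      = ℕₚ.≤-refl ∷ filter-lowered i∈T i∉G i<j xs xs< i∈ (Any.tail (x≢j ∘ sym) j∈xs) sames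
    ...   | no  x∉G rewrite filter-reject (_∈? T) {xs = xs} (x∉G ∘ proj₂ (same x≢i x≢j))
      = filter-lowered i∈T i∉G i<j xs xs< i∈ (Any.tail (x≢j ∘ sym) j∈xs) sames

replace-≤ₚ : {G : Subset n} {i j : Fin n} → i Fin.< j → j ∈ G → i ∉ G → replace G j i ≤ₚ G
replace-≤ₚ {n} {G} {i} {j} i<j j∈G i∉G = filter-lowered j∈G (Exchange.i∉T ex)
  (j∈replace G) i∉G i<j (allFin n) (AllPairsₚ.tabulate⁺-< λ p → p) (∈-allFin i) (∈-allFin j)
  (All.universal same (allFin n))
  where
  ex : Exchange j i G (replace G j i)
  ex = exchange-replace j∈G i∉G
  same : ∀ x → x ≢ i → x ≢ j → (x ∈ G → x ∈ replace G j i) × (x ∈ replace G j i → x ∈ G)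
  same x x≢i x≢j = (λ x∈G → ∈-replace⁺ x∈G x≢j) , λ x∈ → back (∈-replace⁻ G x∈)
    where
    back : x ≡ i ⊎ (x ∈ G × x ≢ j) → x ∈ G
    back (inj₁ x≡i)       = contradiction x≡i x≢i
    back (inj₂ (x∈G , _)) = x∈G

module _ (K : SimplicialComplex n) (k : ℕ) (π : Permutation′ n) where

  open Facets K k

  DownExchangeable : Set
  DownExchangeable = ∀ u v → (π ⟨$⟩ʳ u) Fin.< (π ⟨$⟩ʳ v) → Exchangeable v u

  -- Exchanges are known for facets only, so `G` is extended to a facet `H`. If `H` already contains
  -- the new vertex, then it contains the altered face; otherwise the exchange is made in `H`.
  face-replace : IsPure K k → DownExchangeable → ∀ {G i j} → i Fin.< j → j ∈ G →
    Face (relabel π K) G → Face (relabel π K) (replace G j i)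
  face-replace pure-K exch {G} {i} {j} i<j j∈G G∈K′
    with H , H∈K , size , G⊆H ← IsPure.pure pure-K G∈K′
    with l , refl ← complete H∈K size
    = go (u ∈? face l)
    where
    u v : Fin n
    u = π ⟨$⟩ˡ i
    v = π ⟨$⟩ˡ j
    cases : ∀ {x} → x ∈ preimage π (replace G j i) → x ≡ u ⊎ (x ∈ face l × x ≢ v)
    cases {x} x∈ with ∈-replace⁻ G (∈-preimage⁻ π x∈)
    ... | inj₁ πx≡i          = inj₁ (trans (sym (inverseˡ π)) (cong (π ⟨$⟩ˡ_) πx≡i))
    ... | inj₂ (πx∈G , πx≢j) = inj₂ (G⊆H (∈-preimage⁺ π πx∈G) ,
      λ { refl → πx≢j (inverseʳ π) })
    go : Dec (u ∈ face l) → Face K (preimage π (replace G j i))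
    go (yes u∈H) = down-closed K sub (proj₁ (sound l))
      where
      sub : preimage π (replace G j i) ⊆ face l
      sub x∈ with cases x∈
      ... | inj₁ refl      = u∈H
      ... | inj₂ (x∈H , _) = x∈H
    go (no u∉H) with l′ , ex ← exch u v
                       (subst₂ Fin._<_ (sym (inverseʳ π)) (sym (inverseʳ π)) i<j) l
                       (G⊆H (∈-preimage⁺ π (subst (_∈ G) (sym (inverseʳ π)) j∈G))) u∉H
      = down-closed K sub (proj₁ (sound l′))
      where
      sub : preimage π (replace G j i) ⊆ face l′
      sub {x} x∈ with cases x∈
      ... | inj₁ refl        = Exchange.j∈T ex
      ... | inj₂ (x∈H , x≢v) = p─q⊆p (face l′) ⁅ u ⁆
        (subst (x ∈_) (Exchange.S∖i≡T∖j ex) (x∈p∧x≢y⇒x∈p-y x∈H x≢v))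

  exchangeable⇒shifted : IsPure K k → DownExchangeable → Shifted (relabel π K)
  exchangeable⇒shifted pure-K exch {F} {G} G∈K′ _ F≤G
    with H , H∈K′ , _ , F⊆H ← lower-elements (Face (relabel π K)) (face-replace pure-K exch)
           [] (elements F) (elements G)
           (elements-sorted F) (elements-sorted G) F≤G [] G∈K′ [] (elements⊆ G)
    -- The lowering process ends in a face containing `F`.
    = down-closed (relabel π K) (λ v∈F → All.lookup F⊆H (∈-elements⁺ v∈F)) H∈K′

  shifted⇒exchangeable : Shifted (relabel π K) → DownExchangeable
  shifted⇒exchangeable shifted u v πu<πv l v∈S u∉S =
    let l′ , e = complete T∈K (trans (sym (exchange-size ex)) (proj₂ (sound l)))
    in l′ , subst (Exchange v u S) (sym e) ex
    where
    S G T T′ : Subset n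
    S  = face l
    G  = image π S
    T  = replace S v u
    T′ = replace G (π ⟨$⟩ʳ v) (π ⟨$⟩ʳ u)
    ex : Exchange v u S T
    ex = exchange-replace v∈S u∉S
    πv∈G : π ⟨$⟩ʳ v ∈ G
    πv∈G = ∈-image⁺ π v∈S
    πu∉G : π ⟨$⟩ʳ u ∉ G
    πu∉G = u∉S ∘ ∈-image⁻ π
    T′∈K′ : Face (relabel π K) T′
    T′∈K′ = shifted (subst (Face K) (sym (preimage-image π S)) (proj₁ (sound l)))
      (sym (exchange-size (exchange-replace πv∈G πu∉G))) (replace-≤ₚ πu<πv πv∈G πu∉G)
    -- An inclusion is enough to make `T` a face, by closure under subsets.
    T⊆ : T ⊆ preimage π T′
    T⊆ x∈ with ∈-replace⁻ S x∈
    ... | inj₁ refl        = ∈-preimage⁺ π (j∈replace G)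
    ... | inj₂ (x∈S , x≢v) = ∈-preimage⁺ π (∈-replace⁺ (∈-image⁺ π x∈S)
      λ e → x≢v (trans (sym (inverseˡ π)) (trans (cong (π ⟨$⟩ˡ_) e) (inverseˡ π))))
    T∈K : Face K T
    T∈K = down-closed K T⊆ T′∈K′

-- Sorting

argmax : (f : Fin (suc n) → ℕ) → ∃[ i ] ∀ j → f j ≤ f i
argmax {zero}  f = zero , λ { zero → ℕₚ.≤-refl }
argmax {suc n} f with i , max ← argmax (f ∘ suc) with ℕₚ.≤-total (f zero) (f (suc i))
... | inj₁ f0≤fi = suc i , λ { zero → f0≤fi ; (suc j) → max j }
... | inj₂ fi≤f0 = zero  , λ { zero → ℕₚ.≤-refl ; (suc j) → ℕₚ.≤-trans (max j) fi≤f0 }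

insert-at : ∀ {n} i j (π : Permutation′ n) → insert i j π ⟨$⟩ʳ i ≡ j
insert-at i j π with i Finₚ.≟ i
... | yes _   = refl
... | no  i≢i = contradiction refl i≢i

-- A vertex of largest value is sent to position 0 and the others are sorted recursively behind it;
-- ties may fall either way.
sortingPermutation : (f : Fin n → ℕ) →
  Σ (Permutation′ n) λ π → ∀ u v → (π ⟨$⟩ʳ u) Fin.< (π ⟨$⟩ʳ v) → f v ≤ f u
sortingPermutation {zero}  f = id , λ ()
sortingPermutation {suc n} f
  with i , max ← argmax f with π , sorted ← sortingPermutation (f ∘ punchIn i)
  = σ , sorts
  where
  σ : Permutation′ (suc n)
  σ = insert i zero π
  sorts : ∀ u v → (σ ⟨$⟩ʳ u) Fin.< (σ ⟨$⟩ʳ v) → f v ≤ f u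
  sorts u v lt = go (i Finₚ.≟ u) (i Finₚ.≟ v)
    where
    go : Dec (i ≡ u) → Dec (i ≡ v) → f v ≤ f u
    go (yes refl) _          = max v
    go (no  _)    (yes refl) = contradiction (subst ((σ ⟨$⟩ʳ u) Fin.<_) (insert-at i zero π) lt) λ ()
    go (no  i≢u)  (no  i≢v)  = subst₂ (λ a b → f a ≤ f b) (Finₚ.punchIn-punchOut i≢v) (Finₚ.punchIn-punchOut i≢u)
      (sorted (punchOut i≢u) (punchOut i≢v) (ℕ.s<s⁻¹ (subst₂ Fin._<_ (shape i≢u) (shape i≢v) lt)))
      where
      shape : ∀ {w} (i≢w : i ≢ w) → σ ⟨$⟩ʳ w ≡ suc (π ⟨$⟩ʳ punchOut i≢w)
      shape i≢w = trans (cong (σ ⟨$⟩ʳ_) (sym (Finₚ.punchIn-punchOut i≢w))) (insert-punchIn i zero π (punchOut i≢w))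

-- The spectral inequality and its equality case

theorem3p10 :
    ∀ {c ℓ₁ ℓ₂ ℓ₃} (ℝ : RealNumbers c ℓ₁ ℓ₂ ℓ₃) →
    let module R = RealNumbers ℝ in
    (n k : ℕ) → k ≥ 1 →
    (K : SimplicialComplex n) → IsPure K k →
    (ω : Orientation K) →
    (λs : List R.Carrier) → IsNonzeroSpectrum ℝ (upLaplacian K ω k) λs →
    let LHS = R.sumOfSquares λs
        RHS = R.fromℕ (degᵀ-squares K k)
    in
    (LHS R.≤ RHS)
    × ((LHS R.≈ RHS) ⇔ Σ (SimplicialComplex n) λ K′ → Shifted K′ × K ≅ K′)
    × ((LHS R.≈ RHS) → (π : Permutation′ n) → DegreesDescending (relabel π K) k → Shifted (relabel π K))
theorem3p10 ℝ n k _ K pure-K ω λs spectrum =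
  (λ RHS<LHS → fromℕ-mono-≤ sumOfGramSquares≤RHS (ℝ.<-respʳ-≈ LHS≈ RHS<LHS)) ,
  mk⇔ sorted-shifted tight-of-shifted ,
  (λ LHS≈RHS π descending → exchangeable⇒shifted K k π pure-K λ u v πu<πv →
    tight⇒exchangeable (tight LHS≈RHS) v u
      (subst₂ _≤_ (trans (deg-relabel K k π v) (deg≡degree v)) (trans (deg-relabel K k π u) (deg≡degree u))
        (descending (ℕₚ.<⇒≤ πu<πv))))
  where
  open RealSpectrum ℝ
  module ℝ where
    open RealNumbers ℝ public
    open IsStrictPartialOrder isStrictPartialOrder public using (<-respʳ-≈)
    open CommutativeRing commutativeRing public using () renaming (trans to ≈-trans; sym to ≈-sym; reflexive to ≈-reflexive)
  open Boundary K ω k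
  open Facets K k

  LHS≈ : ℝ.sumOfSquares λs ℝ.≈ ℝ.fromℕ sumOfGramSquares
  LHS≈ = ℝ.≈-trans (sumOfSquares-spectrum L λs spectrum)
    (ℝ.≈-trans (trace²-fromℤ L upLaplacian-symmetric)
      (ℝ.≈-reflexive (cong ℝ.fromℕ upLaplacian-sumOfSquares)))

  sumOfGramSquares≤RHS : sumOfGramSquares ≤ degᵀ-squares K k
  sumOfGramSquares≤RHS = ℕₚ.≤-trans sumOfGramSquares≤sumOfMinima (ℕₚ.≤-reflexive (sym degᵀ-squares≡sumOfMinima))

  Equality : Set _
  Equality = ℝ.sumOfSquares λs ℝ.≈ ℝ.fromℕ (degᵀ-squares K k)

  tight : Equality → sumOfGramSquares ≡ sumOfMinima
  tight LHS≈RHS = trans (fromℕ-injective (ℝ.≈-trans (ℝ.≈-sym LHS≈) LHS≈RHS)) degᵀ-squares≡sumOfMinima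

  sorted-shifted : Equality → Σ (SimplicialComplex n) λ K′ → Shifted K′ × K ≅ K′
  sorted-shifted LHS≈RHS with π , sorted ← sortingPermutation degree =
    relabel π K ,
    exchangeable⇒shifted K k π pure-K
      (λ u v πu<πv → tight⇒exchangeable (tight LHS≈RHS) v u (sorted u v πu<πv)) ,
    π , λ F → mk⇔ (λ x → x) (λ x → x)

  tight-of-shifted : (Σ (SimplicialComplex n) λ K′ → Shifted K′ × K ≅ K′) → Equality
  tight-of-shifted (K′ , shifted , π , iso) = ℝ.≈-trans LHS≈ (ℝ.≈-reflexive
    (cong ℝ.fromℕ (trans (exchangeable⇒tight comparable) (sym degᵀ-squares≡sumOfMinima))))
    where
    shifted-relabel : Shifted (relabel π K)
    shifted-relabel {F} {G} G∈ size F≤G =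
      Equivalence.from (iso F) (shifted (Equivalence.to (iso G) G∈) size F≤G)
    down : DownExchangeable K k π
    down = shifted⇒exchangeable K k π shifted-relabel
    comparable : ∀ u v → Exchangeable u v ⊎ Exchangeable v u
    comparable u v with Finₚ.<-cmp (π ⟨$⟩ʳ u) (π ⟨$⟩ʳ v)
    ... | tri< lt _ _ = inj₂ (down u v lt)
    ... | tri> _ _ gt = inj₁ (down v u gt)
    -- Injectivity of `π` gives `u = v`, where no facet meets the condition for an exchange.
    ... | tri≈ _ e _  = inj₁ λ l u∈ v∉ → contradiction
      (subst (_∈ face l) (trans (sym (inverseˡ π)) (trans (cong (π ⟨$⟩ˡ_) e) (inverseˡ π))) u∈) v∉
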